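{- Let $R$ be a commutative ring and let $A=\bigoplus_{i\in\mathbb{Z}}A_i$ be a commutative, graded $R$-algebra with identity such that each $A_i$ is free of finite rank. For any connected finite graph $G$ with $n$ vertices, the chromatic homology $H^{\mathrm{Ch}}_A(G)$ is supported in homological gradings $0\leq i\leq n-1$; that is, its degree $i$ part vanishes unless $0\le i\le n-1$.
   Context: A finite graph $G=(V,E)$ consists of a finite set $V$ and a set $E$ of 2-element subsets of $V$. Fix an ordering $e_1,\dots,e_m$ of $E$. For $S\subseteq E$, $k(S)$ is the number of connected components of the spanning subgraph with vertex set $V$ and edge set $S$. The chromatic functor $F^{\mathrm{Ch}}=F^{\mathrm{Ch}}_{G,A}$ from the Boolean lattice $2^E$ (subsets of $E$ ordered by inclusion, viewed as a category) to graded $R$-modules with degree-preserving homomorphisms is given by: $F^{\mathrm{Ch}}(S)=A^{\otimes k(S)}$ (tensor product over $R$, one factor for each connected component of $S$); for a cover relation $S\lessdot S\cup\{e\}$, if $e$ joins two distinct components of $S$, then $F^{\mathrm{Ch}}(S\lessdot S\cup\{e\})$ multiplies the two tensor factors of $A$ corresponding to those components, and if $e$ completes a cycle, it is the identity map. Let $c(S\lessdot S\cup\{e_i\})=(-1)^{\#\{e_j\in S\,:\,j<i\}}$. The chromatic homology $H^{\mathrm{Ch}}_A(G)$ is the cohomology of the cochain complex with $C^k=\bigoplus_{|S|=k}F^{\mathrm{Ch}}(S)$ and differential $\delta^k=\sum_{S\lessdot T,\,|S|=k}c(S\lessdot T)F^{\mathrm{Ch}}(S\lessdot T)$; the homological grading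 is the index $k=|S|$. -}

module Defs where

open import Level using (Level; _⊔_; suc)
open import Algebra.Bundles using (CommutativeMonoid; CommutativeRing)
open import Algebra.Module.Bundles using (LeftModule)
open import Algebra.Module.Core using (Opₗ)
open import Algebra.Module.Structures using (IsLeftModule)
open import Algebra.Module.Morphism.Structures using (module LeftModuleMorphisms)
import Algebra.Module.Properties.LeftModule as LeftModuleProperties
import Algebra.Properties.AbelianGroup as AbelianGroupProperties
import Algebra.Properties.CommutativeSemigroup as CommutativeSemigroupProperties
import Algebra.Properties.CommutativeMonoid.Sum as Summation
import Algebra.Properties.Semiring.Exp as Exponentiation
open import Data.Fin.Base as Fin using (Fin; zero)
open import Data.Fin.Properties using (_<?_)
open import Data.Fin.Subset using (Subset; _∈_; _∉_; _∪_; _∩_; ⁅_⁆; ⊤; ∣_∣; inside; outside)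
open import Data.Fin.Subset.Properties using (_∈?_; x∈p∪q⁻; x∈p∪q⁺; x∈⁅y⁆⇒x≡y; x∈⁅x⁆; drop-there; ∪-identityʳ)
import Data.Fin.Properties as Fin
open import Data.Integer.Base as ℤ using (ℤ; +_; 0ℤ)
import Data.Integer.Properties as ℤ
open import Data.List.Base using (List; foldr; map)
import Data.List.Membership.Propositional as List
open import Data.List.Relation.Unary.Unique.Propositional using (Unique)
open import Data.Nat.Base as ℕ using (ℕ)
open import Data.Product using (Σ; ∃; _×_; _,_; proj₁; proj₂)
open import Data.Sum using (_⊎_; inj₁; inj₂; [_,_]′)
open import Data.Vec.Base using (tabulate; _[_]≔_; []; _∷_; here; there)
open import Function.Base using (_∘_)
open import Function.Bundles using (Func; _⟨$⟩_)
open import Function.Definitions using (Injective)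
open import Relation.Binary.Bundles using (Setoid)
open import Relation.Binary.Core using (Rel)
open import Relation.Binary.Definitions using (Decidable)
open import Relation.Binary.Construct.Closure.Equivalence as Eq using (EqClosure)
open import Relation.Binary.Construct.Closure.ReflexiveTransitive using (ε; _◅_)
open import Relation.Binary.Construct.Closure.Symmetric using (fwd; bwd)
open import Relation.Binary.PropositionalEquality using (_≡_; refl; sym; trans; cong; subst)
import Relation.Binary.Reasoning.Setoid as SetoidReasoning
open import Relation.Nullary using (¬_; Dec; yes; no; contradiction)
open import Relation.Nullary.Decidable using (map′; _⊎-dec_; _×-dec_; isYes)
open import Relation.Unary using (Pred)

------------------------------------------------------------------------
-- Modules over a commutative ring (left modules, in the library's terms)

module _ {r ℓr : Level} (R : CommutativeRing r ℓr) where

  private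
    module R = CommutativeRing R

  Mod : (m ℓm : Level) → Set (r ⊔ ℓr ⊔ suc (m ⊔ ℓm))
  Mod m ℓm = LeftModule R.ring m ℓm

  record Hom {m₁ ℓ₁ m₂ ℓ₂ : Level} (M : Mod m₁ ℓ₁) (N : Mod m₂ ℓ₂) : Set (r ⊔ m₁ ⊔ ℓ₁ ⊔ m₂ ⊔ ℓ₂) where
    private
      module M = LeftModule M
      module N = LeftModule N
    open LeftModuleMorphisms M.rawLeftModule N.rawLeftModule using (IsLeftModuleHomomorphism)
    field
      ⟦_⟧                    : M.Carrierᴹ → N.Carrierᴹ
      isLeftModuleHomomorphism : IsLeftModuleHomomorphism ⟦_⟧
    open LeftModuleMorphisms.IsLeftModuleHomomorphism isLeftModuleHomomorphism public

  module _ {m₁ ℓ₁ m₂ ℓ₂ : Level} {M : Mod m₁ ℓ₁} {N : Mod m₂ ℓ₂} where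
    private
      module M = LeftModule M
      module N = LeftModule N

    mkHom : (f : M.Carrierᴹ → N.Carrierᴹ) →
            (∀ {x y} → x M.≈ᴹ y → f x N.≈ᴹ f y) →
            (∀ x y → f (x M.+ᴹ y) N.≈ᴹ f x N.+ᴹ f y) →
            (∀ s x → f (s M.*ₗ x) N.≈ᴹ s N.*ₗ f x) →
            Hom M N
    mkHom f f-cong f-+ f-* = record
      { ⟦_⟧ = f
      ; isLeftModuleHomomorphism = record
        { +ᴹ-isGroupHomomorphism = record
          { isMonoidHomomorphism = record
            { isMagmaHomomorphism = record
              { isRelHomomorphism = record { cong = f-cong }
              ; homo = f-+
              }
            ; ε-homo = f-0
            }
          ; ⁻¹-homo = λ x → LeftModuleProperties.inverseˡ-uniqueᴹ N (f (M.-ᴹ x)) (f x)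
              (N.≈ᴹ-trans (N.≈ᴹ-sym (f-+ (M.-ᴹ x) x)) (N.≈ᴹ-trans (f-cong (M.-ᴹ‿inverseˡ x)) f-0))
          }
        ; *ₗ-homo = f-*
        }
      }
      where
      f-0 : f M.0ᴹ N.≈ᴹ N.0ᴹ
      f-0 = N.≈ᴹ-trans (f-cong (M.≈ᴹ-sym (M.*ₗ-zeroˡ M.0ᴹ)))
              (N.≈ᴹ-trans (f-* R.0# M.0ᴹ) (N.*ₗ-zeroˡ (f M.0ᴹ)))

  IsZero : {m ℓm : Level} → Mod m ℓm → Set (m ⊔ ℓm)
  IsZero M = ∀ x → x ≈ᴹ 0ᴹ
    where open LeftModule M

  record FreeOfFiniteRank {m ℓm : Level} (M : Mod m ℓm) : Set (r ⊔ ℓr ⊔ m ⊔ ℓm) where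
    open LeftModule M
    open Summation +ᴹ-commutativeMonoid using (sum)
    field
      rank   : ℕ
      basis  : Fin rank → Carrierᴹ
      coords : Carrierᴹ → Fin rank → R.Carrier
      spans  : ∀ x → x ≈ᴹ sum (λ k → coords x k *ₗ basis k)
      unique : ∀ x (c : Fin rank → R.Carrier) →
               x ≈ᴹ sum (λ k → c k *ₗ basis k) → ∀ k → c k R.≈ coords x k

  record Submodule {m ℓm : Level} (M : Mod m ℓm) (p : Level) : Set (r ⊔ m ⊔ ℓm ⊔ suc p) where
    open LeftModule M
    field
      Member    : Pred Carrierᴹ p
      resp      : ∀ {x y} → x ≈ᴹ y → Member x → Member y
      0-closed  : Member 0ᴹ
      +-closed  : ∀ {x y} → Member x → Member y → Member (x +ᴹ y)
      *ₗ-closed : ∀ s {x} → Member x → Member (s *ₗ x)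

    -‿closed : ∀ {x} → Member x → Member (-ᴹ x)
    -‿closed {x} mx = resp -1*x≈-x (*ₗ-closed (R.- R.1#) mx)
      where
      open SetoidReasoning ≈ᴹ-setoid
      -1*x≈-x : (R.- R.1#) *ₗ x ≈ᴹ -ᴹ x
      -1*x≈-x = LeftModuleProperties.inverseˡ-uniqueᴹ M _ _ (begin
        (R.- R.1#) *ₗ x +ᴹ x           ≈⟨ +ᴹ-congˡ (*ₗ-identityˡ x) ⟨
        (R.- R.1#) *ₗ x +ᴹ R.1# *ₗ x   ≈⟨ *ₗ-distribʳ x (R.- R.1#) R.1# ⟨
        ((R.- R.1#) R.+ R.1#) *ₗ x     ≈⟨ *ₗ-congʳ (R.-‿inverseˡ R.1#) ⟩
        R.0# *ₗ x                      ≈⟨ *ₗ-zeroˡ x ⟩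
        0ᴹ                             ∎)

    module′ : Mod (m ⊔ p) ℓm
    module′ = record
      { Carrierᴹ = Σ Carrierᴹ Member
      ; _≈ᴹ_ = λ x y → proj₁ x ≈ᴹ proj₁ y
      ; _+ᴹ_ = λ x y → proj₁ x +ᴹ proj₁ y , +-closed (proj₂ x) (proj₂ y)
      ; _*ₗ_ = λ s x → s *ₗ proj₁ x , *ₗ-closed s (proj₂ x)
      ; 0ᴹ = 0ᴹ , 0-closed
      ; -ᴹ_ = λ x → -ᴹ proj₁ x , -‿closed (proj₂ x)
      ; isLeftModule = record
        { isLeftSemimodule = record
          { +ᴹ-isCommutativeMonoid = record
            { isMonoid = record
              { isSemigroup = record
                { isMagma = record
                  { isEquivalence = record { refl = ≈ᴹ-refl ; sym = ≈ᴹ-sym ; trans = ≈ᴹ-trans }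
                  ; ∙-cong = +ᴹ-cong
                  }
                ; assoc = λ x y z → +ᴹ-assoc (proj₁ x) (proj₁ y) (proj₁ z)
                }
              ; identity = (λ x → +ᴹ-identityˡ (proj₁ x)) , (λ x → +ᴹ-identityʳ (proj₁ x))
              }
            ; comm = λ x y → +ᴹ-comm (proj₁ x) (proj₁ y)
            }
          ; isPreleftSemimodule = record
            { *ₗ-cong = *ₗ-cong
            ; *ₗ-zeroˡ = λ x → *ₗ-zeroˡ (proj₁ x)
            ; *ₗ-distribʳ = λ x s t → *ₗ-distribʳ (proj₁ x) s t
            ; *ₗ-identityˡ = λ x → *ₗ-identityˡ (proj₁ x)
            ; *ₗ-assoc = λ s t x → *ₗ-assoc s t (proj₁ x)
            ; *ₗ-zeroʳ = *ₗ-zeroʳ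
            ; *ₗ-distribˡ = λ s x y → *ₗ-distribˡ s (proj₁ x) (proj₁ y)
            }
          }
        ; -ᴹ‿cong = -ᴹ‿cong
        ; -ᴹ‿inverse = (λ x → -ᴹ‿inverseˡ (proj₁ x)) , (λ x → -ᴹ‿inverseʳ (proj₁ x))
        }
      }

  infix 5 _/_
  _/_ : {m ℓm p : Level} (M : Mod m ℓm) → Submodule M p → Mod m p
  _/_ {p = p} M N = record
    { Carrierᴹ = Carrierᴹ
    ; _≈ᴹ_ = _∼_
    ; _+ᴹ_ = _+ᴹ_
    ; _*ₗ_ = _*ₗ_
    ; 0ᴹ = 0ᴹ
    ; -ᴹ_ = -ᴹ_
    ; isLeftModule = record
      { isLeftSemimodule = record
        { +ᴹ-isCommutativeMonoid = record
          { isMonoid = record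
            { isSemigroup = record
              { isMagma = record
                { isEquivalence = record { refl = ⇒∼ ≈ᴹ-refl ; sym = ∼-sym ; trans = ∼-trans }
                ; ∙-cong = ∼-+-cong
                }
              ; assoc = λ x y z → ⇒∼ (+ᴹ-assoc x y z)
              }
            ; identity = (λ x → ⇒∼ (+ᴹ-identityˡ x)) , (λ x → ⇒∼ (+ᴹ-identityʳ x))
            }
          ; comm = λ x y → ⇒∼ (+ᴹ-comm x y)
          }
        ; isPreleftSemimodule = record
          { *ₗ-cong = λ {s} {t} s≈t x∼y → ∼-trans (⇒∼ (*ₗ-congʳ s≈t)) (∼-*-cong t x∼y)
          ; *ₗ-zeroˡ = λ x → ⇒∼ (*ₗ-zeroˡ x)
          ; *ₗ-distribʳ = λ x s t → ⇒∼ (*ₗ-distribʳ x s t)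
          ; *ₗ-identityˡ = λ x → ⇒∼ (*ₗ-identityˡ x)
          ; *ₗ-assoc = λ s t x → ⇒∼ (*ₗ-assoc s t x)
          ; *ₗ-zeroʳ = λ s → ⇒∼ (*ₗ-zeroʳ s)
          ; *ₗ-distribˡ = λ s x y → ⇒∼ (*ₗ-distribˡ s x y)
          }
        }
      ; -ᴹ‿cong = λ {x} {y} x∼y → resp (⁻¹-∙-comm′ x y) (-‿closed x∼y)
      ; -ᴹ‿inverse = (λ x → ⇒∼ (-ᴹ‿inverseˡ x)) , (λ x → ⇒∼ (-ᴹ‿inverseʳ x))
      }
    }
    where
    open LeftModule M
    open Submodule N
    open AbelianGroupProperties +ᴹ-abelianGroup using (⁻¹-∙-comm; ⁻¹-anti-homo‿-; x≈y⇒x∙y⁻¹≈ε)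
    open CommutativeSemigroupProperties (CommutativeMonoid.commutativeSemigroup +ᴹ-commutativeMonoid)
      using (interchange)
    open SetoidReasoning ≈ᴹ-setoid

    _∼_ : Rel Carrierᴹ p
    x ∼ y = Member (x +ᴹ (-ᴹ y))

    ⇒∼ : ∀ {x y} → x ≈ᴹ y → x ∼ y
    ⇒∼ x≈y = resp (≈ᴹ-sym (x≈y⇒x∙y⁻¹≈ε x≈y)) 0-closed

    ∼-sym : ∀ {x y} → x ∼ y → y ∼ x
    ∼-sym {x} {y} x∼y = resp (⁻¹-anti-homo‿- x y) (-‿closed x∼y)

    ∼-trans : ∀ {x y z} → x ∼ y → y ∼ z → x ∼ z
    ∼-trans {x} {y} {z} x∼y y∼z = resp (begin
      (x +ᴹ (-ᴹ y)) +ᴹ (y +ᴹ (-ᴹ z))   ≈⟨ +ᴹ-assoc _ _ _ ⟩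
      x +ᴹ ((-ᴹ y) +ᴹ (y +ᴹ (-ᴹ z)))   ≈⟨ +ᴹ-congˡ (+ᴹ-assoc _ _ _) ⟨
      x +ᴹ (((-ᴹ y) +ᴹ y) +ᴹ (-ᴹ z))   ≈⟨ +ᴹ-congˡ (+ᴹ-congʳ (-ᴹ‿inverseˡ y)) ⟩
      x +ᴹ (0ᴹ +ᴹ (-ᴹ z))              ≈⟨ +ᴹ-congˡ (+ᴹ-identityˡ _) ⟩
      x +ᴹ (-ᴹ z)                      ∎) (+-closed x∼y y∼z)

    ∼-+-cong : ∀ {x y u v} → x ∼ y → u ∼ v → (x +ᴹ u) ∼ (y +ᴹ v)
    ∼-+-cong {x} {y} {u} {v} x∼y u∼v = resp
      (≈ᴹ-trans (interchange x (-ᴹ y) u (-ᴹ v)) (+ᴹ-congˡ (⁻¹-∙-comm y v)))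
      (+-closed x∼y u∼v)

    ∼-*-cong : ∀ s {x y} → x ∼ y → (s *ₗ x) ∼ (s *ₗ y)
    ∼-*-cong s {x} {y} x∼y = resp
      (≈ᴹ-trans (*ₗ-distribˡ s x (-ᴹ y)) (+ᴹ-congˡ
        (LeftModuleProperties.inverseˡ-uniqueᴹ M _ _
          (≈ᴹ-trans (≈ᴹ-sym (*ₗ-distribˡ s (-ᴹ y) y))
            (≈ᴹ-trans (*ₗ-congˡ (-ᴹ‿inverseˡ y)) (*ₗ-zeroʳ s))))))
      (*ₗ-closed s x∼y)

    ⁻¹-∙-comm′ : ∀ x y → -ᴹ (x +ᴹ (-ᴹ y)) ≈ᴹ (-ᴹ x) +ᴹ (-ᴹ (-ᴹ y))
    ⁻¹-∙-comm′ x y = ≈ᴹ-sym (⁻¹-∙-comm x (-ᴹ y))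

  ker : {m₁ ℓ₁ m₂ ℓ₂ : Level} {M : Mod m₁ ℓ₁} {N : Mod m₂ ℓ₂} → Hom M N → Submodule M ℓ₂
  ker {M = M} {N} g = record
    { Member = λ x → ⟦ x ⟧ N.≈ᴹ N.0ᴹ
    ; resp = λ x≈y gx≈0 → N.≈ᴹ-trans (⟦⟧-cong (M.≈ᴹ-sym x≈y)) gx≈0
    ; 0-closed = 0ᴹ-homo
    ; +-closed = λ {x} {y} p q → N.≈ᴹ-trans (+ᴹ-homo x y) (N.≈ᴹ-trans (N.+ᴹ-cong p q) (N.+ᴹ-identityˡ N.0ᴹ))
    ; *ₗ-closed = λ s {x} p → N.≈ᴹ-trans (*ₗ-homo s x) (N.≈ᴹ-trans (N.*ₗ-congˡ p) (N.*ₗ-zeroʳ s))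
    }
    where
    module M = LeftModule M
    module N = LeftModule N
    open Hom g

  -- The elements of a submodule K of M lying in the image of f : L → M.
  imIn : {l ℓl m ℓm p : Level} {L : Mod l ℓl} {M : Mod m ℓm} (K : Submodule M p) → Hom L M →
         Submodule (Submodule.module′ K) (l ⊔ ℓm)
  imIn {L = L} {M} K f = record
    { Member = λ x → ∃ λ y → ⟦ y ⟧ ≈ᴹ proj₁ x
    ; resp = λ { x≈x′ (y , fy≈x) → y , ≈ᴹ-trans fy≈x x≈x′ }
    ; 0-closed = L.0ᴹ , 0ᴹ-homo
    ; +-closed = λ { (y , p) (y′ , p′) → y L.+ᴹ y′ , ≈ᴹ-trans (+ᴹ-homo y y′) (+ᴹ-cong p p′) }
    ; *ₗ-closed = λ { s (y , p) → s L.*ₗ y , ≈ᴹ-trans (*ₗ-homo s y) (*ₗ-congˡ p) }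
    }
    where
    module L = LeftModule L
    open LeftModule M
    open Hom f

  Cohomology : {l ℓl m ℓm n ℓn : Level} {L : Mod l ℓl} {M : Mod m ℓm} {N : Mod n ℓn} →
               Hom L M → Hom M N → Mod (m ⊔ ℓn) (l ⊔ ℓm)
  Cohomology f g = Submodule.module′ (ker g) / imIn (ker g) f

  -- Used below for finite index types, where product and direct sum agree.
  ∏ : {x m ℓm : Level} {X : Set x} → (X → Mod m ℓm) → Mod (x ⊔ m) (x ⊔ ℓm)
  ∏ {X = X} M = record
    { Carrierᴹ = ∀ i → M.Carrierᴹ i
    ; _≈ᴹ_ = λ x y → ∀ i → M._≈ᴹ_ i (x i) (y i)
    ; _+ᴹ_ = λ x y i → M._+ᴹ_ i (x i) (y i)
    ; _*ₗ_ = λ s x i → M._*ₗ_ i s (x i)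
    ; 0ᴹ = λ i → M.0ᴹ i
    ; -ᴹ_ = λ x i → M.-ᴹ_ i (x i)
    ; isLeftModule = record
      { isLeftSemimodule = record
        { +ᴹ-isCommutativeMonoid = record
          { isMonoid = record
            { isSemigroup = record
              { isMagma = record
                { isEquivalence = record
                  { refl = λ i → M.≈ᴹ-refl i
                  ; sym = λ p i → M.≈ᴹ-sym i (p i)
                  ; trans = λ p q i → M.≈ᴹ-trans i (p i) (q i)
                  }
                ; ∙-cong = λ p q i → M.+ᴹ-cong i (p i) (q i)
                }
              ; assoc = λ x y z i → M.+ᴹ-assoc i (x i) (y i) (z i)
              }
            ; identity = (λ x i → M.+ᴹ-identityˡ i (x i)) , (λ x i → M.+ᴹ-identityʳ i (x i))
            }
          ; comm = λ x y i → M.+ᴹ-comm i (x i) (y i)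
          }
        ; isPreleftSemimodule = record
          { *ₗ-cong = λ s≈t p i → M.*ₗ-cong i s≈t (p i)
          ; *ₗ-zeroˡ = λ x i → M.*ₗ-zeroˡ i (x i)
          ; *ₗ-distribʳ = λ x s t i → M.*ₗ-distribʳ i (x i) s t
          ; *ₗ-identityˡ = λ x i → M.*ₗ-identityˡ i (x i)
          ; *ₗ-assoc = λ s t x i → M.*ₗ-assoc i s t (x i)
          ; *ₗ-zeroʳ = λ s i → M.*ₗ-zeroʳ i s
          ; *ₗ-distribˡ = λ s x y i → M.*ₗ-distribˡ i s (x i) (y i)
          }
        }
      ; -ᴹ‿cong = λ p i → M.-ᴹ‿cong i (p i)
      ; -ᴹ‿inverse = (λ x i → M.-ᴹ‿inverseˡ i (x i)) , (λ x i → M.-ᴹ‿inverseʳ i (x i))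
      }
    }
    where module M (i : X) = LeftModule (M i)

------------------------------------------------------------------------
-- Tensor powers M^{⊗I}: one tensor factor for each element of a setoid I,
-- presented by the pure tensors of families I → M modulo multilinearity.

module TensorPower {r ℓr m ℓm i ℓi : Level} (R : CommutativeRing r ℓr)
                   (M : Mod R m ℓm) (I : Setoid i ℓi) where

  private
    module R = CommutativeRing R
    module M = LeftModule M
    module I = Setoid I

  Family : Set (i ⊔ ℓi ⊔ m ⊔ ℓm)
  Family = Func I M.≈ᴹ-setoid

  AgreeAwayFrom : I.Carrier → Family → Family → Set (i ⊔ ℓi ⊔ ℓm)
  AgreeAwayFrom c f g = ∀ j → ¬ (j I.≈ c) → (f ⟨$⟩ j) M.≈ᴹ (g ⟨$⟩ j)

  infixl 6 _⊕_
  infixr 7 _⊙_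
  infixr 8 ⊖_
  infix  4 _≋_

  data Tensor : Set (r ⊔ i ⊔ ℓi ⊔ m ⊔ ℓm) where
    ⨂   : Family → Tensor
    _⊕_ : Tensor → Tensor → Tensor
    𝟘   : Tensor
    ⊖_  : Tensor → Tensor
    _⊙_ : R.Carrier → Tensor → Tensor

  data _≋_ : Tensor → Tensor → Set (r ⊔ ℓr ⊔ i ⊔ ℓi ⊔ m ⊔ ℓm) where
    -- multilinearity
    ⨂-cong  : ∀ f g → (∀ j → (f ⟨$⟩ j) M.≈ᴹ (g ⟨$⟩ j)) → ⨂ f ≋ ⨂ g
    ⨂-+     : ∀ c f g h → AgreeAwayFrom c f h → AgreeAwayFrom c g h →
              (h ⟨$⟩ c) M.≈ᴹ (f ⟨$⟩ c) M.+ᴹ (g ⟨$⟩ c) → ⨂ h ≋ ⨂ f ⊕ ⨂ g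
    ⨂-*     : ∀ c s f h → AgreeAwayFrom c f h →
              (h ⟨$⟩ c) M.≈ᴹ s M.*ₗ (f ⟨$⟩ c) → ⨂ h ≋ s ⊙ ⨂ f
    -- the congruence generated by the module laws
    ≋-refl  : ∀ {x} → x ≋ x
    ≋-sym   : ∀ {x y} → x ≋ y → y ≋ x
    ≋-trans : ∀ {x y z} → x ≋ y → y ≋ z → x ≋ z
    ⊕-cong  : ∀ {x y u v} → x ≋ y → u ≋ v → x ⊕ u ≋ y ⊕ v
    ⊖-cong  : ∀ {x y} → x ≋ y → ⊖ x ≋ ⊖ y
    ⊙-cong  : ∀ {s t x y} → s R.≈ t → x ≋ y → s ⊙ x ≋ t ⊙ y
    ⊕-assoc : ∀ x y z → (x ⊕ y) ⊕ z ≋ x ⊕ (y ⊕ z)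
    ⊕-comm  : ∀ x y → x ⊕ y ≋ y ⊕ x
    ⊕-identityˡ : ∀ x → 𝟘 ⊕ x ≋ x
    ⊖-inverseˡ  : ∀ x → ⊖ x ⊕ x ≋ 𝟘
    ⊙-identityˡ : ∀ x → R.1# ⊙ x ≋ x
    ⊙-assoc     : ∀ s t x → (s R.* t) ⊙ x ≋ s ⊙ (t ⊙ x)
    ⊙-distribˡ  : ∀ s x y → s ⊙ (x ⊕ y) ≋ s ⊙ x ⊕ s ⊙ y
    ⊙-distribʳ  : ∀ x s t → (s R.+ t) ⊙ x ≋ s ⊙ x ⊕ t ⊙ x
    ⊙-zeroˡ     : ∀ x → R.0# ⊙ x ≋ 𝟘
    ⊙-zeroʳ     : ∀ s → s ⊙ 𝟘 ≋ 𝟘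

  tensorPower : Mod R (r ⊔ i ⊔ ℓi ⊔ m ⊔ ℓm) (r ⊔ ℓr ⊔ i ⊔ ℓi ⊔ m ⊔ ℓm)
  tensorPower = record
    { Carrierᴹ = Tensor
    ; _≈ᴹ_ = _≋_
    ; _+ᴹ_ = _⊕_
    ; _*ₗ_ = _⊙_
    ; 0ᴹ = 𝟘
    ; -ᴹ_ = ⊖_
    ; isLeftModule = record
      { isLeftSemimodule = record
        { +ᴹ-isCommutativeMonoid = record
          { isMonoid = record
            { isSemigroup = record
              { isMagma = record
                { isEquivalence = record { refl = ≋-refl ; sym = ≋-sym ; trans = ≋-trans }
                ; ∙-cong = ⊕-cong
                }
              ; assoc = ⊕-assoc
              }
            ; identity = ⊕-identityˡ , (λ x → ≋-trans (⊕-comm x 𝟘) (⊕-identityˡ x))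
            }
          ; comm = ⊕-comm
          }
        ; isPreleftSemimodule = record
          { *ₗ-cong = ⊙-cong
          ; *ₗ-zeroˡ = ⊙-zeroˡ
          ; *ₗ-distribʳ = ⊙-distribʳ
          ; *ₗ-identityˡ = ⊙-identityˡ
          ; *ₗ-assoc = ⊙-assoc
          ; *ₗ-zeroʳ = ⊙-zeroʳ
          ; *ₗ-distribˡ = ⊙-distribˡ
          }
        }
      ; -ᴹ‿cong = ⊖-cong
      ; -ᴹ‿inverse = ⊖-inverseˡ , (λ x → ≋-trans (⊕-comm x (⊖ x)) (⊖-inverseˡ x))
      }
    }

  record Multilinear {n ℓn : Level} (N : Mod R n ℓn) : Set (r ⊔ i ⊔ ℓi ⊔ m ⊔ ℓm ⊔ n ⊔ ℓn) where
    private
      module N = LeftModule N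
    field
      φ      : Family → N.Carrierᴹ
      φ-cong : ∀ f g → (∀ j → (f ⟨$⟩ j) M.≈ᴹ (g ⟨$⟩ j)) → φ f N.≈ᴹ φ g
      φ-+    : ∀ c f g h → AgreeAwayFrom c f h → AgreeAwayFrom c g h →
               (h ⟨$⟩ c) M.≈ᴹ (f ⟨$⟩ c) M.+ᴹ (g ⟨$⟩ c) → φ h N.≈ᴹ φ f N.+ᴹ φ g
      φ-*    : ∀ c s f h → AgreeAwayFrom c f h →
               (h ⟨$⟩ c) M.≈ᴹ s M.*ₗ (f ⟨$⟩ c) → φ h N.≈ᴹ s N.*ₗ φ f

  lift : {n ℓn : Level} {N : Mod R n ℓn} → Multilinear N → Hom R tensorPower N
  lift {N = N} μ = mkHom R lift₀ lift₀-cong (λ _ _ → N.≈ᴹ-refl) (λ _ _ → N.≈ᴹ-refl)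
    where
    module N = LeftModule N
    open Multilinear μ

    lift₀ : Tensor → N.Carrierᴹ
    lift₀ (⨂ f)   = φ f
    lift₀ (x ⊕ y) = lift₀ x N.+ᴹ lift₀ y
    lift₀ 𝟘       = N.0ᴹ
    lift₀ (⊖ x)   = N.-ᴹ lift₀ x
    lift₀ (s ⊙ x) = s N.*ₗ lift₀ x

    lift₀-cong : ∀ {x y} → x ≋ y → lift₀ x N.≈ᴹ lift₀ y
    lift₀-cong (⨂-cong f g p)       = φ-cong f g p
    lift₀-cong (⨂-+ c f g h p q e)  = φ-+ c f g h p q e
    lift₀-cong (⨂-* c s f h p e)    = φ-* c s f h p e
    lift₀-cong ≋-refl               = N.≈ᴹ-refl
    lift₀-cong (≋-sym p)            = N.≈ᴹ-sym (lift₀-cong p)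
    lift₀-cong (≋-trans p q)        = N.≈ᴹ-trans (lift₀-cong p) (lift₀-cong q)
    lift₀-cong (⊕-cong p q)         = N.+ᴹ-cong (lift₀-cong p) (lift₀-cong q)
    lift₀-cong (⊖-cong p)           = N.-ᴹ‿cong (lift₀-cong p)
    lift₀-cong (⊙-cong s≈t p)       = N.*ₗ-cong s≈t (lift₀-cong p)
    lift₀-cong (⊕-assoc x y z)      = N.+ᴹ-assoc _ _ _
    lift₀-cong (⊕-comm x y)         = N.+ᴹ-comm _ _
    lift₀-cong (⊕-identityˡ x)      = N.+ᴹ-identityˡ _
    lift₀-cong (⊖-inverseˡ x)       = N.-ᴹ‿inverseˡ _
    lift₀-cong (⊙-identityˡ x)      = N.*ₗ-identityˡ _
    lift₀-cong (⊙-assoc s t x)      = N.*ₗ-assoc _ _ _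
    lift₀-cong (⊙-distribˡ s x y)   = N.*ₗ-distribˡ _ _ _
    lift₀-cong (⊙-distribʳ x s t)   = N.*ₗ-distribʳ _ _ _
    lift₀-cong (⊙-zeroˡ x)          = N.*ₗ-zeroˡ _
    lift₀-cong (⊙-zeroʳ s)          = N.*ₗ-zeroʳ _

------------------------------------------------------------------------
-- Commutative graded algebras with identity

-- The grading is internal: A is the direct sum of its submodules A_j, that is,
-- every element is a finite sum of homogeneous elements of distinct degrees,
-- and such a sum vanishes only if all its summands do.

record GradedAlgebra {r ℓr : Level} (R : CommutativeRing r ℓr) (a ℓa p : Level)
                     : Set (r ⊔ ℓr ⊔ suc (a ⊔ ℓa ⊔ p)) where
  private
    module R = CommutativeRing R
  infixr 7 _·_
  field
    commutativeRing : CommutativeRing a ℓa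
  open CommutativeRing commutativeRing public
  field
    _·_          : Opₗ R.Carrier Carrier
    isLeftModule : IsLeftModule R.ring _≈_ _+_ 0# -_ _·_
    ·-*-assoc    : ∀ s x y → (s · x) * y ≈ s · (x * y)

  algebraModule : Mod R a ℓa
  algebraModule = record { isLeftModule = isLeftModule }

  field
    graded : ℤ → Submodule R algebraModule p

  Homogeneous : ℤ → Pred Carrier p
  Homogeneous j = Submodule.Member (graded j)

  sumOver : List ℤ → (ℤ → Carrier) → Carrier
  sumOver js x = foldr _+_ 0# (map x js)

  field
    1-homogeneous : Homogeneous 0ℤ 1#
    *-homogeneous : ∀ {j k x y} → Homogeneous j x → Homogeneous k y → Homogeneous (j ℤ.+ k) (x * y)
    decompose     : ∀ x → ∃ λ js → ∃ λ xs → Unique js × (∀ j → Homogeneous j (xs j)) × x ≈ sumOver js xs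
    independent   : ∀ js xs → Unique js → (∀ j → Homogeneous j (xs j)) →
                    sumOver js xs ≈ 0# → ∀ {j} → j List.∈ js → xs j ≈ 0#

  component : ℤ → Mod R (a ⊔ p) ℓa
  component j = Submodule.module′ (graded j)

------------------------------------------------------------------------
-- Finite graphs

-- The vertex set is Fin n.  A 2-element set of vertices is given by its
-- elements in increasing order, and the edge set by an enumeration without
-- repetition e₀, …, e_{m-1}; this is also the chosen ordering of the edges.

record Graph (n : ℕ) : Set where
  field
    m         : ℕ
    ends      : Fin m → Fin n × Fin n
    increasing : ∀ i → proj₁ (ends i) Fin.< proj₂ (ends i)
    distinct  : Injective _≡_ _≡_ ends

module _ {n m : ℕ} where

  Link : (Fin m → Fin n × Fin n) → Subset m → Rel (Fin n) _
  Link ends S u v = ∃ λ i → i ∈ S × ends i ≡ (u , v)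

  -- u and v lie in the same connected component of the spanning subgraph
  -- with edge set S.
  Joined : (Fin m → Fin n × Fin n) → Subset m → Rel (Fin n) _
  Joined ends S = EqClosure (Link ends S)

module _ {n : ℕ} {_⟶_ : Rel (Fin n) Level.zero} {_⟶⁺_ : Rel (Fin n) Level.zero} (a b : Fin n) where

  private
    _∼_ = EqClosure _⟶_

  AtEnds : Fin n → Set
  AtEnds v = v ∼ a ⊎ v ∼ b

  private
    _≈⁺_ : Rel (Fin n) Level.zero
    u ≈⁺ v = u ∼ v ⊎ (AtEnds u × AtEnds v)

    move : ∀ {u v} → v ∼ u → AtEnds u → AtEnds v
    move p = [ (λ q → inj₁ (Eq.transitive _⟶_ p q)) , (λ q → inj₂ (Eq.transitive _⟶_ p q)) ]′

    ≈⁺-trans : ∀ {u v w} → u ≈⁺ v → v ≈⁺ w → u ≈⁺ w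
    ≈⁺-trans (inj₁ p) (inj₁ q) = inj₁ (Eq.transitive _⟶_ p q)
    ≈⁺-trans (inj₁ p) (inj₂ (s , t)) = inj₂ (move p s , t)
    ≈⁺-trans (inj₂ (s , t)) (inj₁ q) = inj₂ (s , move (Eq.symmetric _⟶_ q) t)
    ≈⁺-trans (inj₂ (s , _)) (inj₂ (_ , t)) = inj₂ (s , t)

    ≈⁺-sym : ∀ {u v} → u ≈⁺ v → v ≈⁺ u
    ≈⁺-sym (inj₁ p) = inj₁ (Eq.symmetric _⟶_ p)
    ≈⁺-sym (inj₂ (s , t)) = inj₂ (t , s)

  splitJoined : (∀ {u v} → u ⟶⁺ v → u ⟶ v ⊎ (u , v) ≡ (a , b)) →
                ∀ {u v} → EqClosure _⟶⁺_ u v → u ∼ v ⊎ (AtEnds u × AtEnds v)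
  splitJoined h = Eq.fold
    (record { refl = inj₁ (Eq.reflexive _⟶_) ; sym = ≈⁺-sym ; trans = ≈⁺-trans })
    (λ p → [ (λ q → inj₁ (Eq.return q)) , new ]′ (h p))
    where
    new : ∀ {u v} → (u , v) ≡ (a , b) → u ≈⁺ v
    new refl = inj₂ (inj₁ (Eq.reflexive _⟶_) , inj₂ (Eq.reflexive _⟶_))

  mergeJoined : (∀ {u v} → u ⟶ v → u ⟶⁺ v) → a ⟶⁺ b →
                ∀ {u v} → u ∼ v ⊎ (AtEnds u × AtEnds v) → EqClosure _⟶⁺_ u v
  mergeJoined h ab = [ Eq.map h , (λ { (s , t) → Eq.transitive _⟶⁺_ (toA s) (Eq.symmetric _⟶⁺_ (toA t)) }) ]′
    where
    toA : ∀ {v} → AtEnds v → EqClosure _⟶⁺_ v a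
    toA (inj₁ p) = Eq.map h p
    toA (inj₂ p) = Eq.transitive _⟶⁺_ (Eq.map h p) (Eq.symmetric _⟶⁺_ (Eq.return ab))

joined? : ∀ {n m} (ends : Fin m → Fin n × Fin n) (S : Subset m) → Decidable (Joined ends S)
joined? ends [] u v = map′ (λ { refl → ε }) none (u Fin.≟ v)
  where
  none : ∀ {u v} → Joined ends [] u v → u ≡ v
  none ε = refl
  none (fwd (() , _) ◅ _)
  none (bwd (() , _) ◅ _)
joined? ends (outside ∷ S) u v = map′
  (Eq.map (λ { (i , i∈S , e) → Fin.suc i , there i∈S , e }))
  (Eq.map (λ { (Fin.suc i , there i∈S , e) → i , i∈S , e }))
  (joined? (ends ∘ Fin.suc) S u v)
joined? {n} ends (inside ∷ S) u v = map′
  (mergeJoined a b (λ { (i , i∈S , e) → Fin.suc i , there i∈S , e }) (zero , here , refl))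
  (splitJoined a b λ { (zero , _ , e) → inj₂ (sym e) ; (Fin.suc i , there i∈S , e) → inj₁ (i , i∈S , e) })
  (u ∼? v ⊎-dec (atEnds? u ×-dec atEnds? v))
  where
  a = proj₁ (ends zero)
  b = proj₂ (ends zero)
  _∼?_ = joined? (ends ∘ Fin.suc) S
  atEnds? : ∀ w → Dec (AtEnds {_⟶_ = Link (ends ∘ Fin.suc) S} {_⟶⁺_ = Link ends (inside ∷ S)} a b w)
  atEnds? w = (w ∼? a) ⊎-dec (w ∼? b)

-- A connected graph is taken to have at least one vertex.
Connected : ∀ {n} → Graph n → Set
Connected {n} G = Fin n × (∀ u v → Joined ends ⊤ u v)
  where open Graph G

------------------------------------------------------------------------
-- Chromatic homology

select : {q x : Level} {Q : Set q} {X : Set x} → Dec Q → X → X → X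
select (yes _) x y = x
select (no _)  x y = y

module Chromatic {r ℓr a ℓa p : Level} (R : CommutativeRing r ℓr) (A : GradedAlgebra R a ℓa p)
                 {n : ℕ} (G : Graph n) where

  private
    module R = CommutativeRing R
    module A = GradedAlgebra A
  open Graph G

  infix 4 _⊢_∼_
  _⊢_∼_ : Subset m → Rel (Fin n) _
  S ⊢ u ∼ v = Joined ends S u v

  -- The set of connected components, as the vertex set modulo S ⊢_∼_.
  components : Subset m → Setoid _ _
  components S = Eq.setoid (Link ends S)

  -- S ⋖[ i ] T: the cover relation S ⋖ S ∪ {eᵢ} = T.
  infix 4 _⋖[_]_
  _⋖[_]_ : Subset m → Fin m → Subset m → Set
  S ⋖[ i ] T = i ∉ S × S ∪ ⁅ i ⁆ ≡ T

  module Tens (S : Subset m) = TensorPower R A.algebraModule (components S)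

  -- Underlying R-module of the graded module A^{⊗k(S)}, whose degree-j part is
  -- spanned by tensors of homogeneous elements of total degree j.  The maps of
  -- the complex preserve this grading, so H below is the underlying R-module of
  -- the graded homology, and the latter vanishes exactly when H does.
  F : Subset m → Mod R _ _
  F S = Tens.tensorPower S

  module Cover {S T : Subset m} {i : Fin m} (cover : S ⋖[ i ] T) where

    src tgt : Fin n
    src = proj₁ (ends i)
    tgt = proj₂ (ends i)

    OnEdge : Fin n → Set
    OnEdge v = S ⊢ v ∼ src ⊎ S ⊢ v ∼ tgt

    onEdge? : ∀ v → Dec (OnEdge v)
    onEdge? v = joined? ends S v src ⊎-dec joined? ends S v tgt

    split : ∀ {u v} → T ⊢ u ∼ v → S ⊢ u ∼ v ⊎ (OnEdge u × OnEdge v)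
    split = splitJoined src tgt step
      where
      step : ∀ {u v} → Link ends T u v → Link ends S u v ⊎ (u , v) ≡ (src , tgt)
      step (k , k∈T , e) with x∈p∪q⁻ S ⁅ i ⁆ (subst (k ∈_) (sym (proj₂ cover)) k∈T)
      ... | inj₁ k∈S = inj₁ (k , k∈S , e)
      ... | inj₂ k∈i = inj₂ (trans (sym e) (cong ends (x∈⁅y⁆⇒x≡y i k∈i)))

    extend : ∀ {u v} → S ⊢ u ∼ v → T ⊢ u ∼ v
    extend = Eq.map λ { (k , k∈S , e) → k , subst (k ∈_) (proj₂ cover) (x∈p∪q⁺ (inj₁ k∈S)) , e }

    private
      module M = LeftModule A.algebraModule

    -- eᵢ completes a cycle: S and T have the same components, and a family
    -- indexed by one is a family indexed by the other.
    module Cycle (src∼tgt : S ⊢ src ∼ tgt) where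

      toSrc : ∀ {v} → OnEdge v → S ⊢ v ∼ src
      toSrc (inj₁ q) = q
      toSrc (inj₂ q) = Eq.transitive _ q (Eq.symmetric _ src∼tgt)

      same : ∀ {u v} → T ⊢ u ∼ v → S ⊢ u ∼ v
      same q = [ (λ z → z) , (λ { (s , t) → Eq.transitive _ (toSrc s) (Eq.symmetric _ (toSrc t)) }) ]′ (split q)

      unchanged : Tens.Family S → Tens.Family T
      unchanged f = record { to = Func.to f ; cong = λ q → Func.cong f (same q) }

      identity : Hom R (F S) (F T)
      identity = Tens.lift S record
        { φ      = λ f → Tens.⨂ (unchanged f)
        ; φ-cong = λ f g q → Tens.⨂-cong (unchanged f) (unchanged g) q
        ; φ-+    = λ c f g h q q′ e → Tens.⨂-+ c (unchanged f) (unchanged g) (unchanged h)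
                     (λ j j≁c → q j (λ j∼c → j≁c (extend j∼c))) (λ j j≁c → q′ j (λ j∼c → j≁c (extend j∼c))) e
        ; φ-*    = λ c s f h q e → Tens.⨂-* c s (unchanged f) (unchanged h)
                     (λ j j≁c → q j (λ j∼c → j≁c (extend j∼c))) e
        }

    -- eᵢ joins two distinct components: the component of eᵢ in T receives the
    -- product of the two corresponding factors.
    module Merge (src≁tgt : ¬ S ⊢ src ∼ tgt) where

      at : Tens.Family S → Fin n → A.Carrier
      at f v = select (onEdge? v) ((f ⟨$⟩ src) A.* (f ⟨$⟩ tgt)) (f ⟨$⟩ v)

      move : ∀ {u v} → S ⊢ v ∼ u → OnEdge u → OnEdge v
      move q = [ (λ s → inj₁ (Eq.transitive _ q s)) , (λ s → inj₂ (Eq.transitive _ q s)) ]′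

      at-cong : ∀ f {u v} → T ⊢ u ∼ v → at f u A.≈ at f v
      at-cong f {u} {v} q with onEdge? u | onEdge? v | split q
      ... | yes _  | yes _  | _ = A.refl
      ... | no _   | no _   | inj₁ u∼v = Func.cong f u∼v
      ... | no u∉  | no _   | inj₂ (u∈ , _) = contradiction u∈ u∉
      ... | yes u∈ | no v∉  | inj₁ u∼v = contradiction (move (Eq.symmetric _ u∼v) u∈) v∉
      ... | yes _  | no v∉  | inj₂ (_ , v∈) = contradiction v∈ v∉
      ... | no u∉  | yes v∈ | inj₁ u∼v = contradiction (move u∼v v∈) u∉
      ... | no u∉  | yes _  | inj₂ (u∈ , _) = contradiction u∈ u∉

      multiply : Tens.Family S → Tens.Family T
      multiply f = record { to = at f ; cong = at-cong f }

      src∼tgt : T ⊢ src ∼ tgt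
      src∼tgt = Eq.return (i , subst (i ∈_) (proj₂ cover) (x∈p∪q⁺ (inj₂ (x∈⁅x⁆ i))) , refl)

      toSrc : ∀ {v} → OnEdge v → T ⊢ v ∼ src
      toSrc (inj₁ q) = extend q
      toSrc (inj₂ q) = Eq.transitive _ (extend q) (Eq.symmetric _ src∼tgt)

      away : ∀ c f h → Tens.AgreeAwayFrom S c f h → Tens.AgreeAwayFrom T c (multiply f) (multiply h)
      away c f h q j j≁c with onEdge? j
      ... | no _   = q j (λ j∼c → j≁c (extend j∼c))
      ... | yes j∈ = A.*-cong (q src (λ s → off (inj₁ (Eq.symmetric _ s)))) (q tgt (λ s → off (inj₂ (Eq.symmetric _ s))))
        where
        off : ¬ OnEdge c
        off c∈ = j≁c (Eq.transitive _ (toSrc j∈) (Eq.symmetric _ (toSrc c∈)))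

      ·-comm-* : ∀ s x y → x A.* (s A.· y) A.≈ s A.· (x A.* y)
      ·-comm-* s x y = A.trans (A.*-comm _ _) (A.trans (A.·-*-assoc s y x) (M.*ₗ-congˡ (A.*-comm y x)))

      at-+ : ∀ c f g h → Tens.AgreeAwayFrom S c f h → Tens.AgreeAwayFrom S c g h →
             (h ⟨$⟩ c) A.≈ (f ⟨$⟩ c) A.+ (g ⟨$⟩ c) → at h c A.≈ at f c A.+ at g c
      at-+ c f g h q q′ e with onEdge? c
      ... | no _ = e
      ... | yes (inj₁ c∼src) = A.trans (A.*-cong
              (A.trans (Func.cong h (Eq.symmetric _ c∼src)) (A.trans e (A.+-cong (Func.cong f c∼src) (Func.cong g c∼src))))
              A.refl)
            (A.trans (A.distribʳ _ _ _) (A.+-cong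
              (A.*-cong A.refl (A.sym (q tgt tgt≁c))) (A.*-cong A.refl (A.sym (q′ tgt tgt≁c)))))
        where
        tgt≁c : ¬ S ⊢ tgt ∼ c
        tgt≁c s = src≁tgt (Eq.symmetric _ (Eq.transitive _ s c∼src))
      ... | yes (inj₂ c∼tgt) = A.trans (A.*-cong A.refl
              (A.trans (Func.cong h (Eq.symmetric _ c∼tgt)) (A.trans e (A.+-cong (Func.cong f c∼tgt) (Func.cong g c∼tgt)))))
            (A.trans (A.distribˡ _ _ _) (A.+-cong
              (A.*-cong (A.sym (q src src≁c)) A.refl) (A.*-cong (A.sym (q′ src src≁c)) A.refl)))
        where
        src≁c : ¬ S ⊢ src ∼ c
        src≁c s = src≁tgt (Eq.transitive _ s c∼tgt)

      at-* : ∀ c s f h → Tens.AgreeAwayFrom S c f h →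
             (h ⟨$⟩ c) A.≈ s A.· (f ⟨$⟩ c) → at h c A.≈ s A.· at f c
      at-* c s f h q e with onEdge? c
      ... | no _ = e
      ... | yes (inj₁ c∼src) = A.trans (A.*-cong
              (A.trans (Func.cong h (Eq.symmetric _ c∼src)) (A.trans e (M.*ₗ-congˡ (Func.cong f c∼src))))
              (A.sym (q tgt (λ t → src≁tgt (Eq.symmetric _ (Eq.transitive _ t c∼src))))))
            (A.·-*-assoc s _ _)
      ... | yes (inj₂ c∼tgt) = A.trans (A.*-cong
              (A.sym (q src (λ t → src≁tgt (Eq.transitive _ t c∼tgt))))
              (A.trans (Func.cong h (Eq.symmetric _ c∼tgt)) (A.trans e (M.*ₗ-congˡ (Func.cong f c∼tgt)))))
            (·-comm-* s _ _)

      at-ext : ∀ f g → (∀ j → (f ⟨$⟩ j) A.≈ (g ⟨$⟩ j)) → ∀ j → at f j A.≈ at g j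
      at-ext f g q j with onEdge? j
      ... | yes _ = A.*-cong (q src) (q tgt)
      ... | no _  = q j

      multiplication : Hom R (F S) (F T)
      multiplication = Tens.lift S record
        { φ      = λ f → Tens.⨂ (multiply f)
        ; φ-cong = λ f g q → Tens.⨂-cong (multiply f) (multiply g) (at-ext f g q)
        ; φ-+    = λ c f g h q q′ e → Tens.⨂-+ c (multiply f) (multiply g) (multiply h)
                     (away c f h q) (away c g h q′) (at-+ c f g h q q′ e)
        ; φ-*    = λ c s f h q e → Tens.⨂-* c s (multiply f) (multiply h) (away c f h q) (at-* c s f h q e)
        }

    F-map : Hom R (F S) (F T)
    F-map with joined? ends S src tgt
    ... | yes src∼tgt = Cycle.identity src∼tgt
    ... | no  src≁tgt = Merge.multiplication src≁tgt

  open Exponentiation R.semiring using (_^_)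

  -- c(S ⋖ S ∪ {eᵢ})
  sign : Subset m → Fin m → R.Carrier
  sign S i = (R.- R.1#) ^ ∣ S ∩ tabulate (λ j → isYes (j <? i)) ∣

  record Layer (k : ℤ) : Set where
    constructor layer
    field
      set   : Subset m
      .size : + ∣ set ∣ ≡ k
  open Layer using (set)

  -- Zero when k < 0 or k > m, as then Layer k is empty.
  C : ℤ → Mod R _ _
  C k = ∏ R (λ (σ : Layer k) → F (set σ))

  infixl 5 _∖_
  _∖_ : ∀ {m} → Subset m → Fin m → Subset m
  T ∖ i = T [ i ]≔ outside

  delete : ∀ {m} {T : Subset m} {i} → i ∈ T → i ∉ T ∖ i × (T ∖ i) ∪ ⁅ i ⁆ ≡ T × ℕ.suc ∣ T ∖ i ∣ ≡ ∣ T ∣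
  delete {T = _ ∷ T} here =
    (λ ()) , cong (inside ∷_) (∪-identityʳ T) , refl
  delete {T = outside ∷ _} (there i∈T) with delete i∈T
  ... | i∉ , eq , size = (λ q → i∉ (drop-there q)) , cong (outside ∷_) eq , size
  delete {T = inside ∷ _} (there i∈T) with delete i∈T
  ... | i∉ , eq , size = (λ q → i∉ (drop-there q)) , cong (inside ∷_) eq , cong ℕ.suc size

  size-delete : ∀ {k l} {T : Subset m} {i} → i ∈ T → ℤ.suc k ≡ l → + ∣ T ∣ ≡ l → + ∣ T ∖ i ∣ ≡ k
  size-delete {k} {l} {T} {i} i∈T eq size = trans (sym (ℤ.pred-suc (+ ∣ T ∖ i ∣)))
    (trans (cong ℤ.pred (trans (cong +_ (proj₂ (proj₂ (delete i∈T)))) (trans size (sym eq)))) (ℤ.pred-suc k))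

  removal : ∀ {T i} → i ∈ T → (T ∖ i) ⋖[ i ] T
  removal i∈T = proj₁ (delete i∈T) , proj₁ (proj₂ (delete i∈T))

  -- The T-component of δ x is the sum over eᵢ ∈ T of
  -- c(T ∖ eᵢ ⋖ T) F(T ∖ eᵢ ⋖ T) applied to the (T ∖ eᵢ)-component of x.
  module Differential {k l : ℤ} .(eq : ℤ.suc k ≡ l) where

    private
      module Cₖ = LeftModule (C k)
      module Cₗ = LeftModule (C l)
      module FT (T : Subset m) = LeftModule (F T)

    summand : Cₖ.Carrierᴹ → (τ : Layer l) → Fin m → FT.Carrierᴹ (set τ)
    summand x (layer T size) i with i ∈? T
    ... | yes i∈T = FT._*ₗ_ T (sign (T ∖ i) i)
                      (Hom.⟦_⟧ (Cover.F-map (removal i∈T)) (x (layer (T ∖ i) (size-delete i∈T eq size))))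
    ... | no  _   = FT.0ᴹ T

    δ₀ : Cₖ.Carrierᴹ → Cₗ.Carrierᴹ
    δ₀ x τ = Summation.sum (FT.+ᴹ-commutativeMonoid (set τ)) (summand x τ)

    private
      module Sum (τ : Layer l) = Summation (FT.+ᴹ-commutativeMonoid (set τ))

    summand-cong : ∀ {x y} → x Cₖ.≈ᴹ y → ∀ τ i → FT._≈ᴹ_ (set τ) (summand x τ i) (summand y τ i)
    summand-cong x≈y (layer T size) i with i ∈? T
    ... | yes i∈T = FT.*ₗ-congˡ T (Hom.⟦⟧-cong (Cover.F-map (removal i∈T)) (x≈y _))
    ... | no  _   = FT.≈ᴹ-refl T

    summand-+ : ∀ x y τ i → FT._≈ᴹ_ (set τ) (summand (x Cₖ.+ᴹ y) τ i) (FT._+ᴹ_ (set τ) (summand x τ i) (summand y τ i))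
    summand-+ x y (layer T size) i with i ∈? T
    ... | yes i∈T = FT.≈ᴹ-trans T (FT.*ₗ-congˡ T (Hom.+ᴹ-homo (Cover.F-map (removal i∈T)) _ _)) (FT.*ₗ-distribˡ T _ _ _)
    ... | no  _   = FT.≈ᴹ-sym T (FT.+ᴹ-identityˡ T _)

    summand-* : ∀ s x τ i → FT._≈ᴹ_ (set τ) (summand (s Cₖ.*ₗ x) τ i) (FT._*ₗ_ (set τ) s (summand x τ i))
    summand-* s x (layer T size) i with i ∈? T
    ... | yes i∈T = FT.≈ᴹ-trans T (FT.*ₗ-congˡ T (Hom.*ₗ-homo (Cover.F-map (removal i∈T)) s _))
                      (FT.≈ᴹ-trans T (FT.≈ᴹ-sym T (FT.*ₗ-assoc T _ _ _))
                        (FT.≈ᴹ-trans T (FT.*ₗ-congʳ T (R.*-comm _ _)) (FT.*ₗ-assoc T _ _ _)))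
    ... | no  _   = FT.≈ᴹ-sym T (FT.*ₗ-zeroʳ T s)

    sum-* : ∀ {q} s τ (t : Fin q → FT.Carrierᴹ (set τ)) →
            FT._≈ᴹ_ (set τ) (Sum.sum τ (λ j → FT._*ₗ_ (set τ) s (t j))) (FT._*ₗ_ (set τ) s (Sum.sum τ t))
    sum-* {ℕ.zero}  s τ t = FT.≈ᴹ-sym (set τ) (FT.*ₗ-zeroʳ (set τ) s)
    sum-* {ℕ.suc q} s τ t = FT.≈ᴹ-trans (set τ) (FT.+ᴹ-congˡ (set τ) (sum-* s τ (t ∘ Fin.suc)))
                              (FT.≈ᴹ-sym (set τ) (FT.*ₗ-distribˡ (set τ) s _ _))

    δ : Hom R (C k) (C l)
    δ = mkHom R δ₀
      (λ x≈y τ → Sum.sum-cong-≋ τ (summand-cong x≈y τ))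
      (λ x y τ → FT.≈ᴹ-trans (set τ) (Sum.sum-cong-≋ τ (summand-+ x y τ)) (Sum.∑-distrib-+ τ (summand x τ) (summand y τ)))
      (λ s x τ → FT.≈ᴹ-trans (set τ) (Sum.sum-cong-≋ τ (summand-* s x τ)) (sum-* s τ (summand x τ)))

  open Differential using (δ) public

  H : ℤ → Mod R _ _
  H k = Cohomology R (δ {ℤ.pred k} (ℤ.suc-pred k)) (δ {k} refl)

{-# OPTIONS --safe #-}
module Submission where

-- The chromatic complex is treated as the complex of a cube of modules indexed by the subsets of E,
-- all degrees at once: a cocycle vanishing on all S with |S| < n is shown to be a coboundary, of a
-- cochain vanishing on all S with |S| < n - 1.  Such a complex is the mapping cone of a map between
-- the complexes of two faces of the cube, obtained by deleting and by contracting the first edge.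
-- If this edge is a loop (after the previous contractions), the map is an isomorphism and the cone is
-- acyclic.  Otherwise contraction lowers the number of vertices by one, and a cocycle of the cone is
-- killed by killing its deleted and then its contracted part.  Without edges only degree 0 is left.

open import Defs
open import Algebra.Bundles using (CommutativeMonoid; CommutativeRing)
open import Data.Integer using (ℤ; +_; 0ℤ; 1ℤ; _-_; _≤_)
open import Data.Nat using (ℕ)
open import Algebra.Module.Bundles using (LeftModule)
import Algebra.Module.Properties.LeftModule as LeftModuleProperties
import Algebra.Properties.AbelianGroup as AbelianGroupProperties
import Algebra.Properties.CommutativeMonoid.Sum as Summation
import Algebra.Properties.CommutativeSemigroup as CommutativeSemigroupProperties
import Algebra.Properties.Semiring.Exp as Exponentiation
open import Data.Bool.Base using (Bool)
open import Data.Fin.Base using (Fin; zero; suc; punchIn; punchOut)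
import Data.Fin.Properties as Fin
open import Data.Fin.Properties using (_<?_)
open import Data.Fin.Subset using (Subset; _∈_; _∉_; _∩_; _∪_; ⁅_⁆; ∣_∣; inside; outside; ⊥)
open import Data.Fin.Subset.Properties using (_∈?_; ∉⊥; ∪-identityʳ; drop-there; x∈p∪q⁺; x∈⁅x⁆)
import Data.Integer as ℤ
import Data.Integer.Properties as ℤ
open import Data.Nat.Base as ℕ using (z≤n; s≤s; _<_)
open import Data.Product using (∃; _×_; _,_; proj₁; proj₂)
open import Data.Sum using (_⊎_; inj₁; inj₂; [_,_]′; swap)
open import Data.Vec.Base using (tabulate; []; _∷_; here; there)
open import Data.Vec.Properties using (tabulate-cong)
open import Function.Base using (_∘_; id)
open import Function.Bundles using (Func; _⟨$⟩_)
open import Level using (Level; _⊔_; 0ℓ) renaming (suc to lsuc)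
open import Relation.Binary.Core using (Rel)
open import Relation.Binary.Construct.Closure.Equivalence as Eq using (EqClosure)
import Relation.Binary.Construct.Union as Union
open import Relation.Binary.Definitions using (Decidable)
open import Relation.Binary.PropositionalEquality as ≡ using (_≡_; _≢_; refl; cong; subst)
import Relation.Binary.Reasoning.Setoid as SetoidReasoning
open import Relation.Nullary using (¬_; Dec; yes; no; contradiction; contradiction-irr)
open import Relation.Nullary.Decidable using (isYes; isYes≗does; map′; _⊎-dec_; _×-dec_)

-- Cover relations of subsets, and cubes of modules over them.

data Cover : ∀ {m} → Subset m → Fin m → Subset m → Set where
  here  : ∀ {m} {S : Subset m} → Cover (outside ∷ S) zero (inside ∷ S)
  there : ∀ {m b} {S T : Subset m} {i} → Cover S i T → Cover (b ∷ S) (suc i) (b ∷ T)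

-- The link to the covers of the chromatic functor, which are stated by `∉` and `∪`. The inductive
-- form serves the recursion: passing to a face at the first edge is then the constructor `there`.
toCover : ∀ {m} {S T : Subset m} {i} → Cover S i T → i ∉ S × S ∪ ⁅ i ⁆ ≡ T
toCover {S = _ ∷ S} here = (λ ()) , cong (inside ∷_) (∪-identityʳ S)
toCover {S = outside ∷ _} (there c) with toCover c
... | i∉S , eq = i∉S ∘ drop-there , cong (outside ∷_) eq
toCover {S = inside ∷ _} (there c) with toCover c
... | i∉S , eq = i∉S ∘ drop-there , cong (inside ∷_) eq

module Cubes {r ℓr} (R : CommutativeRing r ℓr) where

  private
    module R = CommutativeRing R
  open Exponentiation R.semiring using (_^_)

  module ModuleProperties {a ℓ} (M : Mod R a ℓ) where
    open LeftModule M
    open AbelianGroupProperties +ᴹ-abelianGroup using (⁻¹-anti-homo‿-; xyx⁻¹≈y; ⁻¹-∙-comm; x∙y⁻¹≈ε⇒x≈y; ε⁻¹≈ε)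
    open CommutativeSemigroupProperties (CommutativeMonoid.commutativeSemigroup +ᴹ-commutativeMonoid)
      using (interchange)
    open SetoidReasoning ≈ᴹ-setoid

    x-0≈x : ∀ x → x +ᴹ -ᴹ 0ᴹ ≈ᴹ x
    x-0≈x x = ≈ᴹ-trans (+ᴹ-congˡ ε⁻¹≈ε) (+ᴹ-identityʳ x)

    x-[x-y]≈y : ∀ x y → x +ᴹ -ᴹ (x +ᴹ -ᴹ y) ≈ᴹ y
    x-[x-y]≈y x y = begin
      x +ᴹ -ᴹ (x +ᴹ -ᴹ y)  ≈⟨ +ᴹ-congˡ (⁻¹-anti-homo‿- x y) ⟩
      x +ᴹ (y +ᴹ -ᴹ x)     ≈⟨ +ᴹ-assoc _ _ _ ⟨
      (x +ᴹ y) +ᴹ -ᴹ x     ≈⟨ xyx⁻¹≈y x y ⟩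
      y                    ∎

    -‿interchange : ∀ x y u v → (x +ᴹ -ᴹ y) +ᴹ -ᴹ (u +ᴹ -ᴹ v) ≈ᴹ (x +ᴹ -ᴹ u) +ᴹ -ᴹ (y +ᴹ -ᴹ v)
    -‿interchange x y u v = begin
      (x +ᴹ -ᴹ y) +ᴹ -ᴹ (u +ᴹ -ᴹ v)       ≈⟨ +ᴹ-congˡ (⁻¹-∙-comm u (-ᴹ v)) ⟨
      (x +ᴹ -ᴹ y) +ᴹ (-ᴹ u +ᴹ -ᴹ (-ᴹ v))  ≈⟨ interchange _ _ _ _ ⟩
      (x +ᴹ -ᴹ u) +ᴹ (-ᴹ y +ᴹ -ᴹ (-ᴹ v))  ≈⟨ +ᴹ-congˡ (⁻¹-∙-comm y (-ᴹ v)) ⟩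
      (x +ᴹ -ᴹ u) +ᴹ -ᴹ (y +ᴹ -ᴹ v)       ∎

    x≈0∧y≈0⇒x-y≈0 : ∀ {x y} → x ≈ᴹ 0ᴹ → y ≈ᴹ 0ᴹ → x +ᴹ -ᴹ y ≈ᴹ 0ᴹ
    x≈0∧y≈0⇒x-y≈0 p q = ≈ᴹ-trans (+ᴹ-cong p (-ᴹ‿cong q)) (x-0≈x 0ᴹ)

    x-y≈0⇒x≈y : ∀ {x y} → x +ᴹ -ᴹ y ≈ᴹ 0ᴹ → x ≈ᴹ y
    x-y≈0⇒x≈y = x∙y⁻¹≈ε⇒x≈y _ _

    -1*x≈-x : ∀ x → (R.- R.1#) *ₗ x ≈ᴹ -ᴹ x
    -1*x≈-x x = LeftModuleProperties.inverseˡ-uniqueᴹ M _ _ (begin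
      (R.- R.1#) *ₗ x +ᴹ x           ≈⟨ +ᴹ-congˡ (*ₗ-identityˡ x) ⟨
      (R.- R.1#) *ₗ x +ᴹ R.1# *ₗ x   ≈⟨ *ₗ-distribʳ x (R.- R.1#) R.1# ⟨
      ((R.- R.1#) R.+ R.1#) *ₗ x     ≈⟨ *ₗ-congʳ (R.-‿inverseˡ R.1#) ⟩
      R.0# *ₗ x                      ≈⟨ *ₗ-zeroˡ x ⟩
      0ᴹ                             ∎)

  -- The inverse is a bare function on carriers; injectivity makes it respect equality and zero.
  record Bijective {a₁ ℓ₁ a₂ ℓ₂} {M : Mod R a₁ ℓ₁} {N : Mod R a₂ ℓ₂} (h : Hom R M N) : Set (a₁ ⊔ ℓ₁ ⊔ a₂ ⊔ ℓ₂) where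
    private
      module M = LeftModule M
      module N = LeftModule N
    open Hom h
    field
      injective : ∀ {x y} → ⟦ x ⟧ N.≈ᴹ ⟦ y ⟧ → x M.≈ᴹ y
      preimage  : N.Carrierᴹ → M.Carrierᴹ
      image     : ∀ y → ⟦ preimage y ⟧ N.≈ᴹ y

    preimage-0 : ∀ {y} → y N.≈ᴹ N.0ᴹ → preimage y M.≈ᴹ M.0ᴹ
    preimage-0 y≈0 = injective (N.≈ᴹ-trans (image _) (N.≈ᴹ-trans y≈0 (N.≈ᴹ-sym 0ᴹ-homo)))

  -- Squares commute without signs; the signs enter only with the differential `δ̂`.
  record Cube (a ℓ : Level) (m : ℕ) : Set (r ⊔ ℓr ⊔ lsuc (a ⊔ ℓ)) where
    field
      F : Subset m → Mod R a ℓ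
      d : ∀ {S T i} → Cover S i T → Hom R (F S) (F T)

    module F S = LeftModule (F S)

    d₀ : ∀ {S T i} → Cover S i T → F.Carrierᴹ S → F.Carrierᴹ T
    d₀ c = Hom.⟦_⟧ (d c)

    field
      commutes : ∀ {S T T′ U i j} (ci : Cover S i T) (cj : Cover T j U) (cj′ : Cover S j T′) (ci′ : Cover T′ i U) →
                 ∀ x → F._≈ᴹ_ U (d₀ cj (d₀ ci x)) (d₀ ci′ (d₀ cj′ x))

    -- Subsets of every size together: restriction to a face is then composition with `b ∷_`, with
    -- no bookkeeping of sizes.
    Cochain : Set a
    Cochain = ∀ S → F.Carrierᴹ S

    infix 4 _≈_
    _≈_ : Cochain → Cochain → Set ℓ
    x ≈ y = ∀ S → F._≈ᴹ_ S (x S) (y S)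

    infixl 6 _-ᶜ_
    _-ᶜ_ : Cochain → Cochain → Cochain
    (x -ᶜ y) S = F._+ᴹ_ S (x S) (F.-ᴹ_ S (y S))

    0̂ : Cochain
    0̂ S = F.0ᴹ S


  -- In the chromatic cube `outside` deletes the first edge and `inside` contracts it, up to
  -- identification of components.
  face : ∀ {a ℓ m} → Bool → Cube a ℓ (ℕ.suc m) → Cube a ℓ m
  face b K = record
    { F        = λ S → F (b ∷ S)
    ; d        = λ c → d (there c)
    ; commutes = λ ci cj cj′ ci′ → commutes (there ci) (there cj) (there cj′) (there ci′)
    }
    where open Cube K

  -- The formula of `Chromatic.sign`, over an arbitrary number of elements so that it can be
  -- unfolded from the first one.
  sgn : ∀ {m} → Subset m → Fin m → R.Carrier
  sgn S i = (R.- R.1#) ^ ∣ S ∩ tabulate (λ j → isYes (j <? i)) ∣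

  smaller-zero : ∀ {m} (S : Subset m) → ∣ S ∩ tabulate {n = m} (λ _ → outside) ∣ ≡ 0
  smaller-zero []            = refl
  smaller-zero (outside ∷ S) = smaller-zero S
  smaller-zero (inside ∷ S)  = smaller-zero S

  isYes-<?-suc : ∀ {m} (j i : Fin m) → isYes (suc j <? suc i) ≡ isYes (j <? i)
  isYes-<?-suc j i = ≡.trans (isYes≗does (suc j <? suc i)) (≡.sym (isYes≗does (j <? i)))

  smaller-suc : ∀ {m} (i : Fin m) → tabulate (λ j → isYes (j <? suc i)) ≡ inside ∷ tabulate (λ j → isYes (j <? i))
  smaller-suc i = cong (inside ∷_) (tabulate-cong (λ j → isYes-<?-suc j i))

  sgn-zero : ∀ {m} (S : Subset m) → sgn (outside ∷ S) zero ≡ R.1#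
  sgn-zero S = cong ((R.- R.1#) ^_) (smaller-zero S)

  sgn-outside : ∀ {m} (S : Subset m) i → sgn (outside ∷ S) (suc i) ≡ sgn S i
  sgn-outside S i = cong (λ P → (R.- R.1#) ^ ∣ (outside ∷ S) ∩ P ∣) (smaller-suc i)

  sgn-inside : ∀ {m} (S : Subset m) i → sgn (inside ∷ S) (suc i) ≡ (R.- R.1#) R.* sgn S i
  sgn-inside S i = cong (λ P → (R.- R.1#) ^ ∣ (inside ∷ S) ∩ P ∣) (smaller-suc i)

  -- The complex of a cube and its exactness in high degrees.

  module _ {a ℓ : Level} where

    -- Each smaller element of T met on the way to i contributes one minus sign,
    -- so the summand of i carries the sign of T ∖ i ⋖ T.
    δ̂ : ∀ {m} (K : Cube a ℓ m) → Cube.Cochain K → Cube.Cochain K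
    δ̂ K x []            = Cube.0̂ K []
    δ̂ K x (outside ∷ S) = δ̂ (face outside K) (x ∘ (outside ∷_)) S
    δ̂ K x (inside ∷ S)  = Cube.d₀ K here (x (outside ∷ S)) +ᴹ -ᴹ δ̂ (face inside K) (x ∘ (inside ∷_)) S
      where open LeftModule (Cube.F K (inside ∷ S))

    δ̂-cong : ∀ {m} (K : Cube a ℓ m) {x y} → Cube._≈_ K x y → Cube._≈_ K (δ̂ K x) (δ̂ K y)
    δ̂-cong K x≈y []            = LeftModule.≈ᴹ-refl (Cube.F K [])
    δ̂-cong K x≈y (outside ∷ S) = δ̂-cong (face outside K) (x≈y ∘ (outside ∷_)) S
    δ̂-cong K x≈y (inside ∷ S)  = +ᴹ-cong (Hom.⟦⟧-cong (Cube.d K here) (x≈y _)) (-ᴹ‿cong (δ̂-cong (face inside K) (x≈y ∘ (inside ∷_)) S))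
      where open LeftModule (Cube.F K (inside ∷ S))

    δ̂-homo-‿- : ∀ {m} (K : Cube a ℓ m) x y → Cube._≈_ K (δ̂ K (Cube._-ᶜ_ K x y)) (Cube._-ᶜ_ K (δ̂ K x) (δ̂ K y))
    δ̂-homo-‿- K x y []            = ≈ᴹ-sym (x-0≈x 0ᴹ)
      where
      open LeftModule (Cube.F K [])
      open ModuleProperties (Cube.F K [])
    δ̂-homo-‿- K x y (outside ∷ S) = δ̂-homo-‿- (face outside K) (x ∘ (outside ∷_)) (y ∘ (outside ∷_)) S
    δ̂-homo-‿- K x y (inside ∷ S)  = ≈ᴹ-trans
      (+ᴹ-cong (≈ᴹ-trans (+ᴹ-homo _ _) (+ᴹ-congˡ (-ᴹ-homo _)))
               (-ᴹ‿cong (δ̂-homo-‿- (face inside K) (x ∘ (inside ∷_)) (y ∘ (inside ∷_)) S)))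
      (-‿interchange _ _ _ _)
      where
      open LeftModule (Cube.F K (inside ∷ S))
      open ModuleProperties (Cube.F K (inside ∷ S))
      open Hom (Cube.d K (here {S = S}))

    -- Each term of the differential at `T` comes from a subset with one element fewer.
    δ̂-local : ∀ {m} (K : Cube a ℓ m) x T → (∀ S → ℕ.suc ∣ S ∣ ≡ ∣ T ∣ → Cube.F._≈ᴹ_ K S (x S) (Cube.0̂ K S)) →
              Cube.F._≈ᴹ_ K T (δ̂ K x T) (Cube.0̂ K T)
    δ̂-local K x []            h = LeftModule.≈ᴹ-refl (Cube.F K [])
    δ̂-local K x (outside ∷ T) h = δ̂-local (face outside K) (x ∘ (outside ∷_)) T (λ S → h (outside ∷ S))
    δ̂-local K x (inside ∷ T)  h = x≈0∧y≈0⇒x-y≈0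
      (≈ᴹ-trans (Hom.⟦⟧-cong (Cube.d K here) (h (outside ∷ T) refl)) (Hom.0ᴹ-homo (Cube.d K here)))
      (δ̂-local (face inside K) (x ∘ (inside ∷_)) T (λ S → h (inside ∷ S) ∘ cong ℕ.suc))
      where
      open LeftModule (Cube.F K (inside ∷ T))
      open ModuleProperties (Cube.F K (inside ∷ T))

    module _ {m} (K L : Cube a ℓ m) where
      private
        module K = Cube K
        module L = Cube L

      record CubeMap : Set (r ⊔ a ⊔ ℓ) where
        field
          φ       : ∀ S → Hom R (K.F S) (L.F S)
          natural : ∀ {S T i} (c : Cover S i T) x →
                    L.F._≈ᴹ_ T (Hom.⟦_⟧ (φ T) (K.d₀ c x)) (L.d₀ c (Hom.⟦_⟧ (φ S) x))

        φ₀ : K.Cochain → L.Cochain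
        φ₀ x S = Hom.⟦_⟧ (φ S) (x S)

    faceMap : ∀ {m} b {K L : Cube a ℓ (ℕ.suc m)} → CubeMap K L → CubeMap (face b K) (face b L)
    faceMap b f = record { φ = λ S → φ (b ∷ S) ; natural = λ c → natural (there c) }
      where open CubeMap f

    δ̂-natural : ∀ {m} {K L : Cube a ℓ m} (f : CubeMap K L) x →
                Cube._≈_ L (CubeMap.φ₀ f (δ̂ K x)) (δ̂ L (CubeMap.φ₀ f x))
    δ̂-natural f x []            = Hom.0ᴹ-homo (CubeMap.φ f [])
    δ̂-natural f x (outside ∷ S) = δ̂-natural (faceMap outside f) (x ∘ (outside ∷_)) S
    δ̂-natural {L = L} f x (inside ∷ S) = ≈ᴹ-trans (+ᴹ-homo _ _)
      (+ᴹ-cong (CubeMap.natural f here _) (≈ᴹ-trans (-ᴹ-homo _) (-ᴹ‿cong (δ̂-natural (faceMap inside f) (x ∘ (inside ∷_)) S))))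
      where
      open LeftModule (Cube.F L (inside ∷ S))
      open Hom (CubeMap.φ f (inside ∷ S))

    -- The full complex of a cube is the mapping cone of this map between those of its two faces.
    edge : ∀ {m} (K : Cube a ℓ (ℕ.suc m)) → CubeMap (face outside K) (face inside K)
    edge K = record
      { φ       = λ S → d here
      ; natural = λ c → commutes (there c) here here (there c)
      }
      where open Cube K

    join : ∀ {m} (K : Cube a ℓ (ℕ.suc m)) → Cube.Cochain (face outside K) → Cube.Cochain (face inside K) → Cube.Cochain K
    join K x y (outside ∷ S) = x S
    join K x y (inside ∷ S)  = y S

    -- Cochains may mix degrees. The bound on the primitive `y` is carried along for the induction:
    -- in `vanishes-cone` it bounds the cocycle handed to the contracted face.
    Vanishes : ∀ {m} → ℕ → Cube a ℓ m → Set (a ⊔ ℓ)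
    Vanishes n K = ∀ x → δ̂ K x ≈ 0̂ → (∀ S → ∣ S ∣ < n → F._≈ᴹ_ S (x S) (0̂ S)) →
                   ∃ λ y → δ̂ K y ≈ x × (∀ S → ℕ.suc ∣ S ∣ < n → F._≈ᴹ_ S (y S) (0̂ S))
      where open Cube K

    -- The only degree is 0, which lies below `suc n`, so the cocycle itself is zero.
    vanishes-point : ∀ {n} (K : Cube a ℓ 0) → Vanishes (ℕ.suc n) K
    vanishes-point K x δx≈0 low = 0̂ , (λ { [] → F.≈ᴹ-sym [] (low [] (s≤s z≤n)) }) , λ S _ → F.≈ᴹ-refl S
      where open Cube K

    -- The primitive is the preimage of the contracted part `x₁` under the edge map, placed on the
    -- deleted face.
    vanishes-loop : ∀ {n m} (K : Cube a ℓ (ℕ.suc m)) → (∀ S → Bijective (Cube.d K (here {S = S}))) → Vanishes n K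
    vanishes-loop {n} K bij x δx≈0 low = y , δy≈x , y-low
      where
      open Cube K
      module B S = Bijective (bij S)
      x₀ = x ∘ (outside ∷_)
      x₁ = x ∘ (inside ∷_)
      y₀ : Cube.Cochain (face outside K)
      y₀ S = B.preimage S (x₁ S)
      y = join K y₀ (λ S → 0̂ (inside ∷ S))

      δ0≈0 : ∀ S → F._≈ᴹ_ (inside ∷ S) (δ̂ (face inside K) (λ S → 0̂ (inside ∷ S)) S) (0̂ (inside ∷ S))
      δ0≈0 S = δ̂-local (face inside K) (λ S → 0̂ (inside ∷ S)) S (λ S _ → F.≈ᴹ-refl _)

      δy≈x : δ̂ K y ≈ x
      -- By injectivity it suffices to compare after the edge map, which turns `y₀` into `x₁`; the
      -- cocycle condition then relates `x₁` to `x₀`.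
      δy≈x (outside ∷ S) = B.injective S (begin
        d₀ here (δ̂ (face outside K) y₀ S)         ≈⟨ δ̂-natural (edge K) y₀ S ⟩
        δ̂ (face inside K) (λ S → d₀ here (y₀ S)) S ≈⟨ δ̂-cong (face inside K) (λ S → B.image S (x₁ S)) S ⟩
        δ̂ (face inside K) x₁ S                    ≈⟨ x-y≈0⇒x≈y (δx≈0 (inside ∷ S)) ⟨
        d₀ here (x₀ S)                            ∎)
        where
        open SetoidReasoning (F.≈ᴹ-setoid (inside ∷ S))
        open ModuleProperties (F (inside ∷ S))
      δy≈x (inside ∷ S) = begin
        d₀ here (y₀ S) +ᴹ -ᴹ δ̂ (face inside K) (λ S → 0̂ (inside ∷ S)) S
                       ≈⟨ +ᴹ-cong (B.image S (x₁ S)) (-ᴹ‿cong (δ0≈0 S)) ⟩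
        x₁ S +ᴹ -ᴹ 0ᴹ  ≈⟨ x-0≈x (x₁ S) ⟩
        x₁ S           ∎
        where
        open LeftModule (F (inside ∷ S))
        open SetoidReasoning ≈ᴹ-setoid
        open ModuleProperties (F (inside ∷ S))

      y-low : ∀ S → ℕ.suc ∣ S ∣ < n → F._≈ᴹ_ S (y S) (0̂ S)
      -- `inside ∷ S` has one element more than `S`, so the bound on `x` there is exactly the one
      -- required of `y` here.
      y-low (outside ∷ S) lt = B.preimage-0 S (low (inside ∷ S) lt)
      y-low (inside ∷ S)  lt = F.≈ᴹ-refl _

    -- Subsets in the contracted face are counted without the first edge, so the bound drops by one
    -- there.
    vanishes-cone : ∀ {n m} (K : Cube a ℓ (ℕ.suc m)) →
                    Vanishes (ℕ.suc n) (face outside K) → Vanishes n (face inside K) → Vanishes (ℕ.suc n) K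
    vanishes-cone {n} K v₀ v₁ x δx≈0 low = y , δy≈x , y-low
      where
      open Cube K
      K₀ = face outside K
      K₁ = face inside K
      open Cube K₁ using () renaming (_-ᶜ_ to _-₁_; _≈_ to _≈₁_; 0̂ to 0₁)
      x₀ = x ∘ (outside ∷_)
      x₁ = x ∘ (inside ∷_)
      f = CubeMap.φ₀ (edge K)
      sol₀ = v₀ x₀ (δx≈0 ∘ (outside ∷_)) (λ S → low (outside ∷ S))
      y₀ = proj₁ sol₀
      δy₀≈x₀ = proj₁ (proj₂ sol₀)
      y₀-low = proj₂ (proj₂ sol₀)
      -- The contracted part of the differential of `y` is `f y₀` minus that of `y₁`; it equals `x₁`
      -- when `y₁` is a primitive of this `z`.
      z : Cube.Cochain K₁
      z = f y₀ -₁ x₁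

      δz≈0 : δ̂ K₁ z ≈₁ 0₁
      δz≈0 S = begin
        δ̂ K₁ z S                               ≈⟨ δ̂-homo-‿- K₁ (f y₀) x₁ S ⟩
        δ̂ K₁ (f y₀) S +ᴹ -ᴹ δ̂ K₁ x₁ S          ≈⟨ +ᴹ-congʳ (δ̂-natural (edge K) y₀ S) ⟨
        d₀ here (δ̂ K₀ y₀ S) +ᴹ -ᴹ δ̂ K₁ x₁ S    ≈⟨ +ᴹ-congʳ (Hom.⟦⟧-cong (d here) (δy₀≈x₀ S)) ⟩
        d₀ here (x₀ S) +ᴹ -ᴹ δ̂ K₁ x₁ S         ≈⟨ δx≈0 (inside ∷ S) ⟩
        0ᴹ                                     ∎
        where
        open LeftModule (F (inside ∷ S))
        open SetoidReasoning ≈ᴹ-setoid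

      z-low : ∀ S → ∣ S ∣ < n → F._≈ᴹ_ (inside ∷ S) (z S) (0̂ (inside ∷ S))
      z-low S lt = ModuleProperties.x≈0∧y≈0⇒x-y≈0 (F (inside ∷ S))
        (F.≈ᴹ-trans _ (Hom.⟦⟧-cong (d here) (y₀-low S (s≤s lt))) (Hom.0ᴹ-homo (d here)))
        (low (inside ∷ S) (s≤s lt))

      sol₁ = v₁ z δz≈0 z-low
      y₁ = proj₁ sol₁
      y = join K y₀ y₁

      δy≈x : δ̂ K y ≈ x
      δy≈x (outside ∷ S) = δy₀≈x₀ S
      δy≈x (inside ∷ S) = ≈ᴹ-trans (+ᴹ-congˡ (-ᴹ‿cong (proj₁ (proj₂ sol₁) S))) (x-[x-y]≈y _ _)
        where
        open LeftModule (F (inside ∷ S))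
        open ModuleProperties (F (inside ∷ S))

      y-low : ∀ S → ℕ.suc ∣ S ∣ < ℕ.suc n → F._≈ᴹ_ S (y S) (0̂ S)
      y-low (outside ∷ S) lt = y₀-low S lt
      y-low (inside ∷ S) (s≤s lt) = proj₂ (proj₂ sol₁) S lt

    -- Identifies the signed sum with the recursive differential. The scalar `s` generalises the
    -- claim so that it can collect the minus signs of the elements of `T` already passed.
    δ̂-sum : ∀ {m} (K : Cube a ℓ m) (x : Cube.Cochain K) T (s : R.Carrier) → let open Cube K in
            (t : Fin m → F.Carrierᴹ T) →
            (∀ {S i} (c : Cover S i T) → F._≈ᴹ_ T (t i) (F._*ₗ_ T s (F._*ₗ_ T (sgn S i) (d₀ c (x S))))) →
            (∀ {i} → i ∉ T → F._≈ᴹ_ T (t i) (F.0ᴹ T)) →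
            F._≈ᴹ_ T (Summation.sum (F.+ᴹ-commutativeMonoid T) t) (F._*ₗ_ T s (δ̂ K x T))
    δ̂-sum K x [] s t t∈ t∉ = ≈ᴹ-sym (*ₗ-zeroʳ s)
      where open LeftModule (Cube.F K [])
    δ̂-sum K x (outside ∷ T) s t t∈ t∉ = ≈ᴹ-trans
      (+ᴹ-cong (t∉ (λ ()))
        (δ̂-sum (face outside K) (x ∘ (outside ∷_)) T s (t ∘ suc)
          (λ {S} {i} c → ≈ᴹ-trans (t∈ (there c)) (*ₗ-congˡ (*ₗ-congʳ (R.reflexive (sgn-outside S i)))))
          (λ i∉T → t∉ (i∉T ∘ drop-there))))
      (+ᴹ-identityˡ _)
      where open LeftModule (Cube.F K (outside ∷ T))
    δ̂-sum K x (inside ∷ T) s t t∈ t∉ = ≈ᴹ-trans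
      (+ᴹ-cong
        (≈ᴹ-trans (t∈ here) (*ₗ-congˡ (≈ᴹ-trans (*ₗ-congʳ (R.reflexive (sgn-zero T))) (*ₗ-identityˡ _))))
        (≈ᴹ-trans
          (δ̂-sum (face inside K) (x ∘ (inside ∷_)) T (s R.* (R.- R.1#)) (t ∘ suc)
            (λ {S} {i} c → ≈ᴹ-trans (t∈ (there c))
              (≈ᴹ-trans (*ₗ-congˡ (≈ᴹ-trans (*ₗ-congʳ (R.reflexive (sgn-inside S i))) (*ₗ-assoc _ _ _))) (≈ᴹ-sym (*ₗ-assoc _ _ _))))
            (λ i∉T → t∉ (i∉T ∘ drop-there)))
          (≈ᴹ-trans (*ₗ-assoc _ _ _) (*ₗ-congˡ (-1*x≈-x _)))))
      (≈ᴹ-sym (*ₗ-distribˡ s _ _))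
      where
      open LeftModule (Cube.F K (inside ∷ T))
      open ModuleProperties (Cube.F K (inside ∷ T))

-- Contraction of an edge, on relations between vertices.

infixl 6 _∪ʳ_
_∪ʳ_ : ∀ {n} → Rel (Fin n) 0ℓ → Rel (Fin n) 0ℓ → Rel (Fin n) 0ℓ
_∪ʳ_ = Union._∪_

-- There are at most `k` classes; several indices may represent the same one.
Represents : ∀ {n k} → Rel (Fin n) 0ℓ → (Fin k → Fin n) → Set
Represents _⟶_ rep = ∀ v → ∃ λ i → EqClosure _⟶_ v (rep i)

module Contraction {n} (B : Rel (Fin n) 0ℓ) (e : Fin n × Fin n) where

  private
    a = proj₁ e
    b = proj₂ e

  B/e : Rel (Fin n) 0ℓ
  B/e = B ∪ʳ λ u v → (u , v) ≡ e

  decidable : Decidable (EqClosure B) → Decidable (EqClosure B/e)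
  decidable _∼?_ u v = map′
    (mergeJoined a b inj₁ (inj₂ refl))
    (splitJoined {_⟶⁺_ = B/e} a b (λ q → q))
    (u ∼? v ⊎-dec (ends? u ×-dec ends? v))
    where ends? = λ w → w ∼? a ⊎-dec w ∼? b

  fewer-representatives : ∀ {k} {rep : Fin (ℕ.suc k) → Fin n} → Represents B rep → ¬ EqClosure B a b →
                          ∃ λ (rep′ : Fin k → Fin n) → Represents B/e rep′
  fewer-representatives {rep = rep} reps a≁b = rep ∘ punchIn j , reps′
    where
    i j : Fin _
    i = proj₁ (reps a)
    j = proj₁ (reps b)
    _∼_ = EqClosure B
    a∼i : a ∼ rep i
    a∼i = proj₂ (reps a)
    b∼j : b ∼ rep j
    b∼j = proj₂ (reps b)

    j≢i : j ≢ i
    j≢i j≡i = a≁b (Eq.transitive B a∼i (subst (λ l → rep l ∼ b) j≡i (Eq.symmetric B b∼j)))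

    punched : ∀ {l v} (j≢l : j ≢ l) → EqClosure B/e v (rep l) → ∃ λ k → EqClosure B/e v (rep (punchIn j k))
    punched {v = v} j≢l v∼l = punchOut j≢l , subst (λ l → EqClosure B/e v (rep l)) (≡.sym (Fin.punchIn-punchOut j≢l)) v∼l

    reps′ : Represents B/e (rep ∘ punchIn j)
    reps′ v with reps v
    ... | l , v∼l with j Fin.≟ l
    ... | no j≢l   = punched j≢l (Eq.map inj₁ v∼l)
    ... | yes refl = punched j≢i (Eq.transitive B/e
      (Eq.map inj₁ (Eq.transitive B v∼l (Eq.symmetric B b∼j)))
      (Eq.transitive B/e (Eq.symmetric B/e (Eq.return (inj₂ refl))) (Eq.map inj₁ a∼i)))

-- Induction over deletion and contraction.

module _ {r ℓr} (R : CommutativeRing r ℓr) {a ℓ : Level} where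
  open Cubes R

  -- B records the edges contracted so far, and K is the cube of the edges still to be treated.
  Graphical : ∀ {n m} → Rel (Fin n) 0ℓ → (Fin m → Fin n × Fin n) → Cube a ℓ m → Set _
  Graphical B ends K = ∀ {S T i} (c : Cover S i T) →
    EqClosure (B ∪ʳ Link ends S) (proj₁ (ends i)) (proj₂ (ends i)) → Bijective (Cube.d K c)

  -- By induction on the number of edges. Deletion keeps the representatives and contraction of a
  -- non-loop saves one, matching the two bounds in `vanishes-cone`.
  vanishes-graphical : ∀ {n m k} {B : Rel (Fin n) 0ℓ} {ends : Fin m → Fin n × Fin n} {K : Cube a ℓ m} {rep : Fin k → Fin n} →
                       Fin n → Decidable (EqClosure B) → Represents B rep → Graphical B ends K → Vanishes k K
  vanishes-graphical {k = ℕ.zero} v _ reps _ with () ← proj₁ (reps v)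
  vanishes-graphical {m = ℕ.zero} {ℕ.suc k} {K = K} _ _ _ _ = vanishes-point K
  vanishes-graphical {n} {ℕ.suc m} {ℕ.suc k} {B} {ends} {K} {rep} v _∼?_ reps graphical
    with proj₁ (ends zero) ∼? proj₂ (ends zero)
  -- The ends are already joined by contracted edges, so the first edge closes a cycle over every
  -- `S`.
  ... | yes loop = vanishes-loop K (λ S → graphical here (Eq.map inj₁ loop))
  ... | no  ¬loop = vanishes-cone K
      (vanishes-graphical v _∼?_ reps (λ c → graphical (there c) ∘ Eq.map deleted))
      (vanishes-graphical v (Contraction.decidable B e _∼?_) (proj₂ fewer) (λ c → graphical (there c) ∘ Eq.map contracted))
    where
    e = ends zero
    fewer = Contraction.fewer-representatives B e {rep = rep} reps ¬loop

    deleted : ∀ {S u w} → (B ∪ʳ Link (ends ∘ suc) S) u w → (B ∪ʳ Link ends (outside ∷ S)) u w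
    deleted (inj₁ q)             = inj₁ q
    deleted (inj₂ (i , i∈S , q)) = inj₂ (suc i , there i∈S , q)

    contracted : ∀ {S u w} → (Contraction.B/e B e ∪ʳ Link (ends ∘ suc) S) u w → (B ∪ʳ Link ends (inside ∷ S)) u w
    contracted (inj₁ (inj₁ q))        = inj₁ q
    contracted (inj₁ (inj₂ q))        = inj₂ (zero , here , ≡.sym q)
    contracted (inj₂ (i , i∈S , q)) = inj₂ (suc i , there i∈S , q)

-- Commuting squares of the chromatic functor, on pure tensors.

module ChromaticCube {r ℓr a ℓa p} (R : CommutativeRing r ℓr) (A : GradedAlgebra R a ℓa p) {n} (G : Graph n) where

  private
    module A = GradedAlgebra A
  open Graph G
  open Chromatic R A G renaming (module Cover to CoverMap)
  open Cubes R

  ∼-refl : ∀ {S v} → S ⊢ v ∼ v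
  ∼-refl {S} = Eq.reflexive (Link ends S)

  ∼-sym : ∀ {S u v} → S ⊢ u ∼ v → S ⊢ v ∼ u
  ∼-sym {S} = Eq.symmetric (Link ends S)

  ∼-trans : ∀ {S u v w} → S ⊢ u ∼ v → S ⊢ v ∼ w → S ⊢ u ∼ w
  ∼-trans {S} = Eq.transitive (Link ends S)

  module Push {S T : Subset m} {i : Fin m} (cover : S ⋖[ i ] T) where

    open CoverMap cover using (src; tgt; OnEdge; onEdge?; split; extend; F-map; module Cycle; module Merge) public

    -- `F-map` sends pure tensors to pure tensors; on the underlying families commutation can be
    -- checked vertex by vertex.
    push : Tens.Family S → Tens.Family T
    push f with joined? ends S src tgt
    ... | yes src∼tgt = Cycle.unchanged src∼tgt f
    ... | no  src≁tgt = Merge.multiply src≁tgt f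

    F-map-⨂ : ∀ f → Hom.⟦_⟧ F-map (Tens.⨂ f) ≡ Tens.⨂ (push f)
    F-map-⨂ f with joined? ends S src tgt
    ... | yes _ = refl
    ... | no  _ = refl

    push-cycle : S ⊢ src ∼ tgt → ∀ f v → (push f ⟨$⟩ v) A.≈ (f ⟨$⟩ v)
    push-cycle src∼tgt f v with joined? ends S src tgt
    ... | yes _       = A.refl
    ... | no  src≁tgt = contradiction src∼tgt src≁tgt

    push-on : ¬ S ⊢ src ∼ tgt → ∀ f {v} → OnEdge v → (push f ⟨$⟩ v) A.≈ (f ⟨$⟩ src) A.* (f ⟨$⟩ tgt)
    push-on src≁tgt f {v} v∈ with joined? ends S src tgt
    ... | yes src∼tgt = contradiction src∼tgt src≁tgt
    ... | no  _ with onEdge? v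
    ... | yes _  = A.refl
    ... | no  v∉ = contradiction v∈ v∉

    push-off : ∀ f {v} → ¬ OnEdge v → (push f ⟨$⟩ v) A.≈ (f ⟨$⟩ v)
    push-off f {v} v∉ with joined? ends S src tgt
    ... | yes _ = A.refl
    ... | no  _ with onEdge? v
    ... | yes v∈ = contradiction v∈ v∉
    ... | no  _  = A.refl

    src∼tgt : T ⊢ src ∼ tgt
    src∼tgt = Eq.return (i , subst (i ∈_) (proj₂ cover) (x∈p∪q⁺ (inj₂ (x∈⁅x⁆ i))) , refl)

    joined : ∀ {u v} → OnEdge u → OnEdge v → T ⊢ u ∼ v
    joined u∈ v∈ = ∼-trans (toSrc u∈) (∼-sym (toSrc v∈))
      where
      toSrc : ∀ {v} → OnEdge v → T ⊢ v ∼ src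
      toSrc (inj₁ q) = extend q
      toSrc (inj₂ q) = ∼-trans (extend q) (∼-sym src∼tgt)

    move : ∀ {u v} → S ⊢ u ∼ v → OnEdge v → OnEdge u
    move q = [ inj₁ ∘ ∼-trans q , inj₂ ∘ ∼-trans q ]′

    -- The edge joins the component of `u` to that of `v`, in either orientation. Commutativity of
    -- the algebra makes the orientation immaterial in `push-Ends`.
    Ends : Fin n → Fin n → Set
    Ends u v = (S ⊢ u ∼ src × S ⊢ v ∼ tgt) ⊎ (S ⊢ u ∼ tgt × S ⊢ v ∼ src)

    Ends⇒OnEdge : ∀ {u v} → Ends u v → OnEdge u × OnEdge v
    Ends⇒OnEdge (inj₁ (p , q)) = inj₁ p , inj₂ q
    Ends⇒OnEdge (inj₂ (p , q)) = inj₂ p , inj₁ q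

    OnEdge⇒near : ∀ {u v w} → Ends u v → OnEdge w → S ⊢ w ∼ u ⊎ S ⊢ w ∼ v
    OnEdge⇒near (inj₁ (p , q)) = [ (λ s → inj₁ (∼-trans s (∼-sym p))) , (λ s → inj₂ (∼-trans s (∼-sym q))) ]′
    OnEdge⇒near (inj₂ (p , q)) = [ (λ s → inj₂ (∼-trans s (∼-sym q))) , (λ s → inj₁ (∼-trans s (∼-sym p))) ]′

    push-Ends : ¬ S ⊢ src ∼ tgt → ∀ f {u v w} → Ends u v → OnEdge w →
                (push f ⟨$⟩ w) A.≈ (f ⟨$⟩ u) A.* (f ⟨$⟩ v)
    push-Ends src≁tgt f (inj₁ (p , q)) w∈ = A.trans (push-on src≁tgt f w∈)
      (A.*-cong (Func.cong f (∼-sym p)) (Func.cong f (∼-sym q)))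
    push-Ends src≁tgt f (inj₂ (p , q)) w∈ = A.trans (push-on src≁tgt f w∈)
      (A.trans (A.*-comm _ _) (A.*-cong (Func.cong f (∼-sym p)) (Func.cong f (∼-sym q))))

  record Square (S T T′ U : Subset m) (i j : Fin m) : Set where
    constructor square
    field
      S⋖T  : S ⋖[ i ] T
      T⋖U  : T ⋖[ j ] U
      S⋖T′ : S ⋖[ j ] T′
      T′⋖U : T′ ⋖[ i ] U

  flip : ∀ {S T T′ U i j} → Square S T T′ U i j → Square S T′ T U j i
  flip (square S⋖T T⋖U S⋖T′ T′⋖U) = square S⋖T′ T′⋖U S⋖T T⋖U

  -- The path through `T`; the one through `T′` is the same module at `flip □`. `J` is the edge `j`
  -- over `S`, and `J⁺` the same edge after `i` has been added.
  module Composite {S T T′ U i j} (□ : Square S T T′ U i j) (f : Tens.Family S) where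

    open Square □
    module I  = Push S⋖T
    module J  = Push S⋖T′
    module J⁺ = Push T⋖U

    value : Fin n → A.Carrier
    value v = J⁺.push (I.push f) ⟨$⟩ v

    extend-OnEdge : ∀ {v} → J.OnEdge v → J⁺.OnEdge v
    extend-OnEdge = [ inj₁ ∘ I.extend , inj₂ ∘ I.extend ]′

    value-parallel : T ⊢ J.src ∼ J.tgt → ∀ v → value v A.≈ (I.push f ⟨$⟩ v)
    value-parallel J-cycle = J⁺.push-cycle J-cycle (I.push f)

    -- The component of `v` does not grow when `i` is added, so `v` stays off `j`.
    value-off : ∀ {v} → ¬ I.OnEdge v → ¬ J.OnEdge v → value v A.≈ (f ⟨$⟩ v)
    value-off {v} v∉I v∉J = A.trans (J⁺.push-off (I.push f) v∉J⁺) (I.push-off f v∉I)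
      where
      reflect : ∀ {w} → T ⊢ v ∼ w → S ⊢ v ∼ w
      reflect q = [ id , (λ (v∈I , _) → contradiction v∈I v∉I) ]′ (I.split q)
      v∉J⁺ : ¬ J⁺.OnEdge v
      v∉J⁺ = [ v∉J ∘ inj₁ ∘ reflect , v∉J ∘ inj₂ ∘ reflect ]′

    -- The edges meet in the component of `u`: the first merges it with that of `v`, the second
    -- merges the result with that of `w`, which the first left alone.
    value-path : ∀ {u v w} → ¬ S ⊢ I.src ∼ I.tgt → ¬ T ⊢ J.src ∼ J.tgt → I.Ends u v → J.Ends u w → ¬ I.OnEdge w →
                 ∀ {x} → I.OnEdge x ⊎ J.OnEdge x → value x A.≈ ((f ⟨$⟩ u) A.* (f ⟨$⟩ v)) A.* (f ⟨$⟩ w)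
    value-path {u} {v} {w} I-edge J-edge uv uw w∉I {x} x∈ = A.trans
      (J⁺.push-Ends J-edge (I.push f) uw⁺ (x∈J⁺ x∈))
      (A.*-cong (I.push-Ends I-edge f uv u∈I) (I.push-off f w∉I))
      where
      u∈I : I.OnEdge u
      u∈I = proj₁ (I.Ends⇒OnEdge uv)
      uw⁺ : J⁺.Ends u w
      uw⁺ = [ (λ (p , q) → inj₁ (I.extend p , I.extend q)) , (λ (p , q) → inj₂ (I.extend p , I.extend q)) ]′ uw
      x∈J⁺ : I.OnEdge x ⊎ J.OnEdge x → J⁺.OnEdge x
      x∈J⁺ (inj₁ x∈I) = J⁺.move (I.joined x∈I u∈I) (proj₁ (J⁺.Ends⇒OnEdge uw⁺))
      x∈J⁺ (inj₂ x∈J) = extend-OnEdge x∈J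

    module _ (src∉I : ¬ I.OnEdge J.src) (tgt∉I : ¬ I.OnEdge J.tgt) where

      value-disjoint-on : ¬ T ⊢ J.src ∼ J.tgt → ∀ {v} → J.OnEdge v → value v A.≈ (f ⟨$⟩ J.src) A.* (f ⟨$⟩ J.tgt)
      value-disjoint-on J-edge v∈J = A.trans (J⁺.push-on J-edge (I.push f) (extend-OnEdge v∈J))
        (A.*-cong (I.push-off f src∉I) (I.push-off f tgt∉I))

      value-disjoint-off : ∀ {v} → ¬ J.OnEdge v → value v A.≈ (I.push f ⟨$⟩ v)
      value-disjoint-off {v} v∉J = J⁺.push-off (I.push f) [ v∉J ∘ inj₁ ∘ reflect src∉I , v∉J ∘ inj₂ ∘ reflect tgt∉I ]′
        where
        reflect : ∀ {w} → ¬ I.OnEdge w → T ⊢ v ∼ w → S ⊢ v ∼ w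
        reflect w∉I q = [ id , (λ (_ , w∈I) → contradiction w∈I w∉I) ]′ (I.split q)

  module Commute {S T T′ U i j} (□ : Square S T T′ U i j) (f : Tens.Family S) where

    open Square □
    module L = Composite □ f
    module ℛ = Composite (flip □) f
    open L using (module I; module J)
    open CommutativeSemigroupProperties A.*-commutativeSemigroup using (xy∙z≈xz∙y)

    -- Adding `i` changes no component, so both paths amount to the push along `j` alone.
    value-cycle : S ⊢ I.src ∼ I.tgt → ∀ v → L.value v A.≈ ℛ.value v
    value-cycle I-cycle v = A.trans (lhs v) (A.sym (ℛ.value-parallel (J.extend I-cycle) v))
      where
      same = I.Cycle.same I-cycle
      lhs : ∀ v → L.value v A.≈ (J.push f ⟨$⟩ v)
      lhs v with joined? ends S J.src J.tgt
      ... | yes J-cycle = A.trans (L.value-parallel (I.extend J-cycle) v)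
              (I.push-cycle I-cycle f v)
      ... | no J-edge with J.onEdge? v
      ... | yes v∈J = A.trans (L.J⁺.push-on (J-edge ∘ same) (I.push f) (L.extend-OnEdge v∈J))
                        (A.*-cong (I.push-cycle I-cycle f _) (I.push-cycle I-cycle f _))
      ... | no v∉J = A.trans (L.J⁺.push-off (I.push f) [ v∉J ∘ inj₁ ∘ same , v∉J ∘ inj₂ ∘ same ]′)
                       (I.push-cycle I-cycle f v)

    aligned : ¬ S ⊢ J.src ∼ J.tgt → I.OnEdge J.src → I.OnEdge J.tgt → I.Ends J.src J.tgt
    aligned J-edge (inj₁ p) (inj₁ q) = contradiction (∼-trans p (∼-sym q)) J-edge
    aligned J-edge (inj₁ p) (inj₂ q) = inj₁ (p , q)
    aligned J-edge (inj₂ p) (inj₁ q) = inj₂ (p , q)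
    aligned J-edge (inj₂ p) (inj₂ q) = contradiction (∼-trans p (∼-sym q)) J-edge

    Ends⊆J : ∀ {u v} → I.Ends u v → J.OnEdge u → J.OnEdge v → J.OnEdge I.src × J.OnEdge I.tgt
    Ends⊆J (inj₁ (p , q)) u∈J v∈J = J.move (∼-sym p) u∈J , J.move (∼-sym q) v∈J
    Ends⊆J (inj₂ (p , q)) u∈J v∈J = J.move (∼-sym q) v∈J , J.move (∼-sym p) u∈J

    module Edges (I-edge : ¬ S ⊢ I.src ∼ I.tgt) (J-edge : ¬ S ⊢ J.src ∼ J.tgt) where

      -- Once either edge is added the other closes a cycle, so each path multiplies once, and the
      -- same two factors.
      value-parallel : I.OnEdge J.src → I.OnEdge J.tgt → ∀ v → L.value v A.≈ ℛ.value v
      value-parallel src∈I tgt∈I v = A.trans (L.value-parallel (I.joined src∈I tgt∈I) v)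
        (A.trans pushes-agree (A.sym (ℛ.value-parallel (J.joined (proj₁ I⊆J) (proj₂ I⊆J)) v)))
        where
        J-ends = aligned J-edge src∈I tgt∈I
        I⊆J = Ends⊆J J-ends (inj₁ ∼-refl) (inj₂ ∼-refl)
        pushes-agree : (I.push f ⟨$⟩ v) A.≈ (J.push f ⟨$⟩ v)
        pushes-agree with J.onEdge? v
        ... | yes v∈J = A.trans (I.push-Ends I-edge f J-ends ([ (λ q → I.move q src∈I) , (λ q → I.move q tgt∈I) ]′ v∈J))
                          (A.sym (J.push-on J-edge f v∈J))
        ... | no v∉J = A.trans (I.push-off f (v∉J ∘ I.OnEdge⇒near J-ends)) (A.sym (J.push-off f v∉J))

      module _ (apart : ¬ (J.OnEdge I.src × J.OnEdge I.tgt)) where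

        -- Both paths multiply the factors at `u`, `v` and `w`, in different orders.
        value-path : ∀ {u v w} → ¬ T ⊢ J.src ∼ J.tgt → ¬ T′ ⊢ I.src ∼ I.tgt →
                     I.Ends u v → J.Ends u w → ¬ I.OnEdge w → ∀ x → L.value x A.≈ ℛ.value x
        value-path J-edge⁺ I-edge⁺ uv uw w∉I x with I.onEdge? x ⊎-dec J.onEdge? x
        ... | no x∉  = A.trans (L.value-off (x∉ ∘ inj₁) (x∉ ∘ inj₂)) (A.sym (ℛ.value-off (x∉ ∘ inj₂) (x∉ ∘ inj₁)))
        ... | yes x∈ = A.trans (L.value-path I-edge J-edge⁺ uv uw w∉I x∈)
                         (A.trans (xy∙z≈xz∙y _ _ _) (A.sym (ℛ.value-path J-edge I-edge⁺ uw uv v∉J (swap x∈))))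
          where
          v∉J = λ v∈J → apart (Ends⊆J uv (proj₁ (J.Ends⇒OnEdge uw)) v∈J)

        -- No vertex lies on both edges, so the two merges act on disjoint sets of vertices.
        value-disjoint : ¬ T ⊢ J.src ∼ J.tgt → ¬ T′ ⊢ I.src ∼ I.tgt →
                         ¬ I.OnEdge J.src → ¬ I.OnEdge J.tgt → ∀ v → L.value v A.≈ ℛ.value v
        value-disjoint J-edge⁺ I-edge⁺ src∉I tgt∉I v = compare (J.onEdge? v) (I.onEdge? v)
          where
          src∉J : ¬ J.OnEdge I.src
          src∉J = [ src∉I ∘ inj₁ ∘ ∼-sym , tgt∉I ∘ inj₁ ∘ ∼-sym ]′
          tgt∉J : ¬ J.OnEdge I.tgt
          tgt∉J = [ src∉I ∘ inj₂ ∘ ∼-sym , tgt∉I ∘ inj₂ ∘ ∼-sym ]′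
          compare : Dec (J.OnEdge v) → Dec (I.OnEdge v) → L.value v A.≈ ℛ.value v
          compare (yes v∈J) (yes v∈I) = contradiction v∈I
            ([ (λ q → src∉I ∘ I.move (∼-sym q)) , (λ q → tgt∉I ∘ I.move (∼-sym q)) ]′ v∈J)
          compare (yes v∈J) (no v∉I) = A.trans (L.value-disjoint-on src∉I tgt∉I J-edge⁺ v∈J)
            (A.sym (A.trans (ℛ.value-disjoint-off src∉J tgt∉J v∉I) (J.push-on J-edge f v∈J)))
          compare (no v∉J) (yes v∈I) = A.trans (L.value-disjoint-off src∉I tgt∉I v∉J)
            (A.trans (I.push-on I-edge f v∈I) (A.sym (ℛ.value-disjoint-on src∉J tgt∉J I-edge⁺ v∈I)))
          compare (no v∉J) (no v∉I) = A.trans (L.value-off v∉I v∉J) (A.sym (ℛ.value-off v∉J v∉I))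

  -- If neither edge closes a cycle over S, they join the same two components, or meet in one
  -- component u (joining it to v and to w, say), or are disjoint.
  push-commutes : ∀ {S T T′ U i j} (□ : Square S T T′ U i j) f v → Composite.value □ f v A.≈ Composite.value (flip □) f v
  push-commutes {S} {T} {T′} □ f v = compare (joined? ends S I.src I.tgt) (joined? ends S J.src J.tgt)
    where
    open Composite □ f using (module I; module J)
    open Commute □ f using (aligned; Ends⊆J; module Edges)
    module Flip = Commute (flip □) f
    Goal = Composite.value □ f v A.≈ Composite.value (flip □) f v

    compare-edges : ¬ S ⊢ I.src ∼ I.tgt → ¬ S ⊢ J.src ∼ J.tgt → Dec (I.OnEdge J.src) → Dec (I.OnEdge J.tgt) → Goal
    compare-edges I-edge J-edge = decide
      where
      open Edges I-edge J-edge

      module Apart (apart : ¬ (I.OnEdge J.src × I.OnEdge J.tgt)) where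
        apart′ : ¬ (J.OnEdge I.src × J.OnEdge I.tgt)
        apart′ (p , q) = apart (Flip.Ends⊆J (Flip.aligned I-edge p q) (inj₁ ∼-refl) (inj₂ ∼-refl))
        -- Adding `i` could join the ends of `j` only if both lay on `i`, which `apart` excludes.
        J-edge⁺ : ¬ T ⊢ J.src ∼ J.tgt
        J-edge⁺ = [ J-edge , apart ]′ ∘ I.split
        I-edge⁺ : ¬ T′ ⊢ I.src ∼ I.tgt
        I-edge⁺ = [ I-edge , apart′ ]′ ∘ J.split
        path = λ {u v w} → value-path apart′ {u} {v} {w} J-edge⁺ I-edge⁺
        disjoint = value-disjoint apart′ J-edge⁺ I-edge⁺

      decide : Dec (I.OnEdge J.src) → Dec (I.OnEdge J.tgt) → Goal
      decide (yes src∈I) (yes tgt∈I) = value-parallel src∈I tgt∈I v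
      -- In these four cases `u` is the end of `j` on `i`, `v` the end of `i` in the other
      -- component, and `w` the other end of `j`.
      decide (yes (inj₁ p)) (no tgt∉I) = Apart.path (tgt∉I ∘ proj₂) (inj₁ (p , ∼-refl)) (inj₁ (∼-refl , ∼-refl)) tgt∉I v
      decide (yes (inj₂ p)) (no tgt∉I) = Apart.path (tgt∉I ∘ proj₂) (inj₂ (p , ∼-refl)) (inj₁ (∼-refl , ∼-refl)) tgt∉I v
      decide (no src∉I) (yes (inj₁ p)) = Apart.path (src∉I ∘ proj₁) (inj₁ (p , ∼-refl)) (inj₂ (∼-refl , ∼-refl)) src∉I v
      decide (no src∉I) (yes (inj₂ p)) = Apart.path (src∉I ∘ proj₁) (inj₂ (p , ∼-refl)) (inj₂ (∼-refl , ∼-refl)) src∉I v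
      decide (no src∉I) (no tgt∉I) = Apart.disjoint (src∉I ∘ proj₁) src∉I tgt∉I v

    compare : Dec (S ⊢ I.src ∼ I.tgt) → Dec (S ⊢ J.src ∼ J.tgt) → Goal
    compare (yes I-cycle) _            = Commute.value-cycle □ f I-cycle v
    compare _            (yes J-cycle) = A.sym (Flip.value-cycle J-cycle v)
    compare (no I-edge)  (no J-edge)   = compare-edges I-edge J-edge (I.onEdge? J.src) (I.onEdge? J.tgt)

-- The chromatic functor as a cube.

module Complex {r ℓr a ℓa p} (R : CommutativeRing r ℓr) (A : GradedAlgebra R a ℓa p) {n} (G : Graph n) where

  private
    module R = CommutativeRing R
    module A = GradedAlgebra A
  open Graph G
  open Chromatic R A G renaming (module Cover to CoverMap)
  open Cubes R
  open ChromaticCube R A G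

  infixr 9 _∘ₕ_
  _∘ₕ_ : ∀ {a₁ ℓ₁ a₂ ℓ₂ a₃ ℓ₃} {L : Mod R a₁ ℓ₁} {M : Mod R a₂ ℓ₂} {N : Mod R a₃ ℓ₃} → Hom R M N → Hom R L M → Hom R L N
  _∘ₕ_ {N = N} g h = mkHom R (λ x → g.⟦ h.⟦ x ⟧ ⟧) (g.⟦⟧-cong ∘ h.⟦⟧-cong)
    (λ x y → N.≈ᴹ-trans (g.⟦⟧-cong (h.+ᴹ-homo x y)) (g.+ᴹ-homo _ _))
    (λ s x → N.≈ᴹ-trans (g.⟦⟧-cong (h.*ₗ-homo s x)) (g.*ₗ-homo s _))
    where
    module g = Hom g
    module h = Hom h
    module N = LeftModule N

  idₕ : ∀ {a ℓ} {M : Mod R a ℓ} → Hom R M M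
  idₕ {M = M} = mkHom R id id (λ _ _ → ≈ᴹ-refl) (λ _ _ → ≈ᴹ-refl)
    where open LeftModule M

  module _ {S : Subset m} {b ℓ} {N : Mod R b ℓ} (g h : Hom R (F S) N) where
    private
      module g = Hom g
      module h = Hom h
    open TensorPower
    open LeftModule N

    -- Pure tensors generate the tensor power as a module.
    tensor-ext : (∀ f → g.⟦ ⨂ f ⟧ ≈ᴹ h.⟦ ⨂ f ⟧) → ∀ x → g.⟦ x ⟧ ≈ᴹ h.⟦ x ⟧
    tensor-ext e (⨂ f)   = e f
    tensor-ext e (x ⊕ y) = ≈ᴹ-trans (g.+ᴹ-homo x y) (≈ᴹ-trans (+ᴹ-cong (tensor-ext e x) (tensor-ext e y)) (≈ᴹ-sym (h.+ᴹ-homo x y)))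
    tensor-ext e 𝟘       = ≈ᴹ-trans g.0ᴹ-homo (≈ᴹ-sym h.0ᴹ-homo)
    tensor-ext e (⊖ x)   = ≈ᴹ-trans (g.-ᴹ-homo x) (≈ᴹ-trans (-ᴹ‿cong (tensor-ext e x)) (≈ᴹ-sym (h.-ᴹ-homo x)))
    tensor-ext e (s ⊙ x) = ≈ᴹ-trans (g.*ₗ-homo s x) (≈ᴹ-trans (*ₗ-congˡ (tensor-ext e x)) (≈ᴹ-sym (h.*ₗ-homo s x)))

  private
    module FS S = LeftModule (F S)

  F₀ : ∀ {S T i} → S ⋖[ i ] T → FS.Carrierᴹ S → FS.Carrierᴹ T
  F₀ c = Hom.⟦_⟧ (CoverMap.F-map c)

  -- Needed because `removal` and `toCover` prove the same cover differently; the values of the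
  -- resulting families do not see the proof.
  F-map-irrelevant : ∀ {S T i} (c c′ : S ⋖[ i ] T) x → FS._≈ᴹ_ T (F₀ c x) (F₀ c′ x)
  F-map-irrelevant {S} {T} {i} c c′ = tensor-ext (CoverMap.F-map c) (CoverMap.F-map c′) pure
    where
    pure : ∀ f → FS._≈ᴹ_ T (F₀ c (Tens.⨂ f)) (F₀ c′ (Tens.⨂ f))
    pure f with joined? ends S (proj₁ (ends i)) (proj₂ (ends i))
    ... | yes _ = Tens.⨂-cong _ _ (λ _ → A.refl)
    ... | no  _ = Tens.⨂-cong _ _ (λ _ → A.refl)

  F-map-commutes : ∀ {S T T′ U i j} (□ : Square S T T′ U i j) → let open Square □ in
                   ∀ x → FS._≈ᴹ_ U (F₀ T⋖U (F₀ S⋖T x)) (F₀ T′⋖U (F₀ S⋖T′ x))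
  F-map-commutes {U = U} □ = tensor-ext
    (CoverMap.F-map T⋖U ∘ₕ CoverMap.F-map S⋖T) (CoverMap.F-map T′⋖U ∘ₕ CoverMap.F-map S⋖T′) pure
    where
    open Square □
    F-map²-⨂ : ∀ {S T U i j} (c : S ⋖[ i ] T) (c′ : T ⋖[ j ] U) f →
               F₀ c′ (F₀ c (Tens.⨂ f)) ≡ Tens.⨂ (Push.push c′ (Push.push c f))
    F-map²-⨂ c c′ f = ≡.trans (cong (F₀ c′) (Push.F-map-⨂ c f)) (Push.F-map-⨂ c′ _)
    pure : ∀ f → FS._≈ᴹ_ U (F₀ T⋖U (F₀ S⋖T (Tens.⨂ f))) (F₀ T′⋖U (F₀ S⋖T′ (Tens.⨂ f)))
    pure f rewrite F-map²-⨂ S⋖T T⋖U f | F-map²-⨂ S⋖T′ T′⋖U f = Tens.⨂-cong _ _ (push-commutes □ f)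

  -- `S` and `T` have the same components, so families over `T` restrict to families over `S`, and
  -- restriction is the inverse.
  F-map-bijective : ∀ {S T i} (c : S ⋖[ i ] T) → S ⊢ proj₁ (ends i) ∼ proj₂ (ends i) → Bijective (CoverMap.F-map c)
  F-map-bijective {S} {T} c cycle = record
    { injective = λ {x} {y} e → FS.≈ᴹ-trans S (FS.≈ᴹ-sym S (left x))
                    (FS.≈ᴹ-trans S (Hom.⟦⟧-cong restriction e) (left y))
    ; preimage  = Hom.⟦_⟧ restriction
    ; image     = right
    }
    where
    open Push c
    open Cycle cycle using (same)

    restrict : Tens.Family T → Tens.Family S
    restrict f = record { to = f ⟨$⟩_ ; cong = Func.cong f ∘ extend }

    restriction : Hom R (F T) (F S)
    restriction = Tens.lift T record
      { φ      = λ f → Tens.⨂ (restrict f)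
      ; φ-cong = λ f g q → Tens.⨂-cong (restrict f) (restrict g) q
      ; φ-+    = λ c f g h q q′ e → Tens.⨂-+ c (restrict f) (restrict g) (restrict h)
                   (λ j j≁c → q j (j≁c ∘ same)) (λ j j≁c → q′ j (j≁c ∘ same)) e
      ; φ-*    = λ c s f h q e → Tens.⨂-* c s (restrict f) (restrict h) (λ j j≁c → q j (j≁c ∘ same)) e
      }

    left : ∀ x → FS._≈ᴹ_ S (Hom.⟦_⟧ restriction (F₀ c x)) x
    left = tensor-ext (restriction ∘ₕ F-map) idₕ pure
      where
      pure : ∀ f → FS._≈ᴹ_ S (Hom.⟦_⟧ restriction (F₀ c (Tens.⨂ f))) (Tens.⨂ f)
      pure f rewrite F-map-⨂ f = Tens.⨂-cong _ _ (push-cycle cycle f)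

    right : ∀ y → FS._≈ᴹ_ T (F₀ c (Hom.⟦_⟧ restriction y)) y
    right = tensor-ext (F-map ∘ₕ restriction) idₕ pure
      where
      pure : ∀ f → FS._≈ᴹ_ T (F₀ c (Tens.⨂ (restrict f))) (Tens.⨂ f)
      pure f rewrite F-map-⨂ (restrict f) = Tens.⨂-cong _ _ (push-cycle cycle (restrict f))

  chromaticCube : Cube _ _ m
  chromaticCube = record
    { F        = F
    ; d        = λ c → CoverMap.F-map (toCover c)
    ; commutes = λ ci cj cj′ ci′ → F-map-commutes (square (toCover ci) (toCover cj) (toCover cj′) (toCover ci′))
    }

  open Cube chromaticCube using (Cochain; d₀)

  -- The induction starts with nothing contracted: `Link ends ⊥` is empty and each of the `n`
  -- vertices represents itself, whence the bound `n`.
  vanishes : Fin n → Vanishes n chromaticCube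
  vanishes v = vanishes-graphical R v (joined? ends ⊥) (λ v → v , ∼-refl)
    (λ c cycle → F-map-bijective (toCover c) (Eq.map forget cycle))
    where
    forget : ∀ {S u v} → (Link ends ⊥ ∪ʳ Link ends S) u v → Link ends S u v
    forget (inj₁ (_ , i∈⊥ , _)) = contradiction i∈⊥ ∉⊥
    forget (inj₂ q)             = q

  -- Comparison with the complex graded by size.

  cover-∖ : ∀ {m} {S T : Subset m} {i} → Cover S i T → T ∖ i ≡ S
  cover-∖ here      = refl
  cover-∖ (there c) = cong (_ ∷_) (cover-∖ c)

  cover-∈ : ∀ {m} {S T : Subset m} {i} → Cover S i T → i ∈ T
  cover-∈ here      = here
  cover-∈ (there c) = there (cover-∈ c)

  open Layer using (set)

  -- At a set of size `k + 1` the differential `δ̂` only sees sets of size `k`, where the two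
  -- cochains agree.
  δ-extends : ∀ {k l} .(eq : ℤ.suc k ≡ l) (x̂ : Cochain) (x : LeftModule.Carrierᴹ (C k)) →
              (∀ σ → FS._≈ᴹ_ (set σ) (x̂ (set σ)) (x σ)) →
              ∀ τ → FS._≈ᴹ_ (set τ) (Hom.⟦_⟧ (δ {k} {l} eq) x τ) (δ̂ chromaticCube x̂ (set τ))
  δ-extends {k} {l} eq x̂ x agree τ@(layer T size) = FS.≈ᴹ-trans T
    (δ̂-sum chromaticCube x̂ T R.1# (summand x τ) summand∈ summand∉) (FS.*ₗ-identityˡ T _)
    where
    open Differential {k} {l} eq using (summand)
    open LeftModule (F T)

    summand∈ : ∀ {S i} (c : Cover S i T) → summand x τ i ≈ᴹ R.1# *ₗ sgn S i *ₗ d₀ c (x̂ S)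
    -- Identifying `S` with `T` without `i` makes the sign and the argument of the summand match.
    summand∈ {S} {i} c with refl ← cover-∖ c with i ∈? T
    ... | no  i∉T = contradiction (cover-∈ c) i∉T
    ... | yes i∈T = ≈ᴹ-trans (*ₗ-congˡ (≈ᴹ-trans (F-map-irrelevant (removal i∈T) (toCover c) _)
                      (Hom.⟦⟧-cong (CoverMap.F-map (toCover c)) (FS.≈ᴹ-sym S (agree (layer S _))))))
                      (≈ᴹ-sym (*ₗ-identityˡ _))

    summand∉ : ∀ {i} → i ∉ T → summand x τ i ≈ᴹ 0ᴹ
    summand∉ {i} i∉T with i ∈? T
    ... | no  _   = ≈ᴹ-refl
    ... | yes i∈T = contradiction i∈T i∉T

  module _ {k : ℤ} where

    extendByZero : LeftModule.Carrierᴹ (C k) → Cochain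
    extendByZero x S with + ∣ S ∣ ℤ.≟ k
    ... | yes size = x (layer S size)
    ... | no  _    = FS.0ᴹ S

    extendByZero-on : ∀ x σ → FS._≈ᴹ_ (set σ) (extendByZero x (set σ)) (x σ)
    extendByZero-on x (layer S size) with + ∣ S ∣ ℤ.≟ k
    ... | yes _  = FS.≈ᴹ-refl S
    ... | no  ≢k = contradiction-irr size ≢k

    extendByZero-off : ∀ x {S} → + ∣ S ∣ ≢ k → FS._≈ᴹ_ S (extendByZero x S) (FS.0ᴹ S)
    extendByZero-off x {S} ≢k with + ∣ S ∣ ℤ.≟ k
    ... | yes ≡k = contradiction ≡k ≢k
    ... | no  _  = FS.≈ᴹ-refl S

    -- In size `k + 1` this is the hypothesis; in any other size the contributing subsets do not
    -- have size `k`, and the extension is zero on them.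
    extendByZero-cocycle : ∀ x → LeftModule._≈ᴹ_ (C (ℤ.suc k)) (Hom.⟦_⟧ (δ {k} refl) x) (LeftModule.0ᴹ (C (ℤ.suc k))) →
                           ∀ T → FS._≈ᴹ_ T (δ̂ chromaticCube (extendByZero x) T) (FS.0ᴹ T)
    extendByZero-cocycle x δx≈0 T with + ∣ T ∣ ℤ.≟ ℤ.suc k
    ... | yes size = FS.≈ᴹ-trans T
          (FS.≈ᴹ-sym T (δ-extends refl (extendByZero x) x (extendByZero-on x) (layer T size))) (δx≈0 (layer T size))
    ... | no  ≢suc = δ̂-local chromaticCube (extendByZero x) T
          (λ S ∣T∣ → extendByZero-off x (λ ∣S∣ → ≢suc (≡.trans (cong +_ (≡.sym ∣T∣)) (cong ℤ.suc ∣S∣))))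

  -- Sets with fewer than `n` elements have sizes within the range, hence different from `i`, and
  -- the extension by zero vanishes on them. This treats negative and large `i` alike.
  H-vanishes : Fin n → ∀ i → ¬ (0ℤ ≤ i × i ≤ + n - 1ℤ) → IsZero R (H i)
  H-vanishes v i outside-range (x , δx≈0) = (λ σ → ŷ (set σ)) , δy≈x
    where
    x̂ = extendByZero x

    low : ∀ S → ∣ S ∣ ℕ.< n → FS._≈ᴹ_ S (x̂ S) (FS.0ᴹ S)
    low S lt = extendByZero-off x {S} λ size → outside-range
      (subst (λ k → 0ℤ ≤ k × k ≤ + n - 1ℤ) size (ℤ.+≤+ ℕ.z≤n , bound lt))
      where
      bound : ∀ {k n} → k ℕ.< n → + k ≤ + n - 1ℤ
      bound (ℕ.s≤s k≤n) = ℤ.+≤+ k≤n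

    solution = vanishes v x̂ (extendByZero-cocycle x δx≈0) low
    ŷ = proj₁ solution

    -- Being zero in the quotient means that `x` minus 0 is a coboundary.
    δy≈x : ∀ σ → let open LeftModule (F (set σ)) in
           Hom.⟦_⟧ (δ (ℤ.suc-pred i)) (λ σ → ŷ (set σ)) σ ≈ᴹ x σ +ᴹ -ᴹ 0ᴹ
    δy≈x σ = begin
      Hom.⟦_⟧ (δ (ℤ.suc-pred i)) (λ σ → ŷ (set σ)) σ
        ≈⟨ δ-extends (ℤ.suc-pred i) ŷ (λ σ → ŷ (set σ)) (λ σ → FS.≈ᴹ-refl (set σ)) σ ⟩
      δ̂ chromaticCube ŷ (set σ)  ≈⟨ proj₁ (proj₂ solution) (set σ) ⟩
      x̂ (set σ)                  ≈⟨ extendByZero-on x σ ⟩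
      x σ                        ≈⟨ ModuleProperties.x-0≈x (F (set σ)) (x σ) ⟨
      x σ +ᴹ -ᴹ 0ᴹ               ∎
      where
      open LeftModule (F (set σ))
      open SetoidReasoning ≈ᴹ-setoid

corollary5p11 : ∀ {r ℓr a ℓa p : Level} (R : CommutativeRing r ℓr) (A : GradedAlgebra R a ℓa p) →
    (∀ j → FreeOfFiniteRank R (GradedAlgebra.component A j)) →
    ∀ {n : ℕ} (G : Graph n) → Connected G →
    ∀ (i : ℤ) → ¬ (0ℤ ≤ i × i ≤ + n - 1ℤ) → IsZero R (Chromatic.H R A G i)
corollary5p11 R A _ G (v , _) = Complex.H-vanishes R A G v
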